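{- For every integer $n\geqslant 4$, the $4$-component connectivity of the $n$-dimensional alternating group network satisfies $\kappa_4(AN_n)=3n-6$.
   Context: Let $\mathbb{Z}_n=\{1,2,\ldots,n\}$ and let $A_n$ be the set of even permutations of $\mathbb{Z}_n$, written as strings $p=(p_1p_2\cdots p_n)$. For $n\geqslant 3$ the alternating group network $AN_n$ is the graph with vertex set $A_n$ in which $p=(p_1\cdots p_n)$ and $q=(q_1\cdots q_n)$ are adjacent if and only if one of the following holds: (i) $p_1=q_2$, $p_2=q_3$, $p_3=q_1$ and $p_j=q_j$ for all $j\notin\{1,2,3\}$; (ii) $p_1=q_3$, $p_2=q_1$, $p_3=q_2$ and $p_j=q_j$ for all $j\notin\{1,2,3\}$; (iii) there is $i\in\{4,\ldots,n\}$ with $p_1=q_2$, $p_2=q_1$, $p_3=q_i$, $p_i=q_3$ and $p_j=q_j$ for all $j\notin\{1,2,3,i\}$. For a graph $G$ and an integer $\ell\geqslant 2$, the $\ell$-component connectivity $\kappa_\ell(G)$ is the minimum number of vertices whose removal from $G$ results in a disconnected graph with at least $\ell$ components or a graph with fewer than $\ell$ vertices. -}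

module Defs where

open import Data.Nat using (ℕ; zero; suc; _+_; _*_; _<ᵇ_; _≤_; _<_)
open import Data.Nat.Divisibility using (_∣_)
open import Data.Bool using (Bool; true; false; _∧_; if_then_else_)
open import Data.Fin using (Fin; toℕ)
open import Data.Vec using (Vec; []; _∷_; lookup; _[_]≔_)
open import Data.List using (List; length; map; allFin)
open import Data.Nat.ListAction using (sum)
open import Data.List.Membership.Propositional using (_∉_)
open import Data.List.Relation.Unary.All using (All)
open import Data.List.Relation.Unary.Unique.Propositional using (Unique)
open import Data.Product using (Σ; _×_; _,_)
open import Data.Sum using (_⊎_)
open import Relation.Binary.PropositionalEquality using (_≡_; _≢_)
open import Relation.Nullary using (¬_)

record Graph : Set₁ where
  field
    V    : Set
    Vert : V → Set
    Adj  : V → V → Set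

module _ (G : Graph) where
  open Graph G

  Alive : List V → V → Set
  Alive S v = Vert v × v ∉ S

  -- Reach S u v : there is a walk from u to v in G - S
  -- (all vertices after u lie in G - S; u itself is assumed alive by users)
  data Reach (S : List V) : V → V → Set where
    here : ∀ {u} → Reach S u u
    step : ∀ {u w v} → Adj u w → Alive S w → Reach S w v → Reach S u v

  AtLeastComponents : ℕ → List V → Set
  AtLeastComponents ℓ S =
    Σ (Vec V ℓ) λ xs →
      (∀ i → Alive S (lookup xs i)) ×
      (∀ i j → i ≢ j → ¬ Reach S (lookup xs i) (lookup xs j))

  FewerVertices : ℕ → List V → Set
  FewerVertices ℓ S =
    ¬ (Σ (Vec V ℓ) λ xs →
        (∀ i → Alive S (lookup xs i)) ×
        (∀ i j → i ≢ j → lookup xs i ≢ lookup xs j))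

  VertexSet : List V → Set
  VertexSet S = All Vert S × Unique S

  ComponentCut : ℕ → List V → Set
  ComponentCut ℓ S = AtLeastComponents ℓ S ⊎ FewerVertices ℓ S

  ComponentConnectivity : ℕ → ℕ → Set
  ComponentConnectivity ℓ k =
    (Σ (List V) λ S → VertexSet S × length S ≡ k × ComponentCut ℓ S) ×
    (∀ S → VertexSet S → ComponentCut ℓ S → k ≤ length S)

-- Even permutations of {1,…,k}, written as strings (p_1 … p_k);
-- values and positions are 0-indexed via Fin k.

inversions : ∀ {k} → Vec (Fin k) k → ℕ
inversions {k} p =
  sum (map (λ i → sum (map (λ j →
    if (toℕ i <ᵇ toℕ j) ∧ (toℕ (lookup p j) <ᵇ toℕ (lookup p i)) then 1 else 0)
    (allFin k))) (allFin k))

IsPermutation : ∀ {k} → Vec (Fin k) k → Set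
IsPermutation p = ∀ i j → lookup p i ≡ lookup p j → i ≡ j

IsEvenPermutation : ∀ {k} → Vec (Fin k) k → Set
IsEvenPermutation p = IsPermutation p × (2 ∣ inversions p)

-- The alternating group network AN_n for n = 3 + m

module _ {A : Set} {m : ℕ} where
  rot₁ : Vec A (3 + m) → Vec A (3 + m)
  rot₁ (a ∷ b ∷ c ∷ r) = c ∷ a ∷ b ∷ r

  rot₂ : Vec A (3 + m) → Vec A (3 + m)
  rot₂ (a ∷ b ∷ c ∷ r) = b ∷ c ∷ a ∷ r

  -- rule (iii) with position 4 + i (i : Fin m):
  -- q_1 = p_2, q_2 = p_1, q_3 = p_{4+i}, q_{4+i} = p_3, rest equal
  swp : Fin m → Vec A (3 + m) → Vec A (3 + m)
  swp i (a ∷ b ∷ c ∷ r) = b ∷ a ∷ lookup r i ∷ (r [ i ]≔ c)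

ANAdj : ∀ m → Vec (Fin (3 + m)) (3 + m) → Vec (Fin (3 + m)) (3 + m) → Set
ANAdj m p q = (q ≡ rot₁ p) ⊎ (q ≡ rot₂ p) ⊎ Σ (Fin m) (λ i → q ≡ swp i p)

AN : ℕ → Graph
AN m = record
  { V    = Vec (Fin (3 + m)) (3 + m)
  ; Vert = IsEvenPermutation
  ; Adj  = ANAdj m
  }

{-# OPTIONS --safe #-}

-- Dropping the first two symbols identifies AN_n with the (n,n-2)-star graph
-- on injective tuples of length n-2: the other symbols determine these two up
-- to their order, which evenness fixes.  Walks are replaced by colourings
-- that are constant along the edges between non-faulty vertices; removing F
-- leaves at most j components when every such colouring takes at most j values.
--
-- Upper bound: in the hexagon 10r - 01r - 21r - 12r - 02r - 20r, the vertices
-- 10r, 21r, 02r have 3n-6 neighbours altogether.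
--
-- Lower bound: by induction on n, at most 1, 2, 3 colours survive n-2, 2n-4,
-- 3n-7 faults.  Fixing the second symbol splits the graph into n copies, and
-- every vertex has exactly one neighbour outside its copy.  A copy with fewer
-- than n-2 faults is monochromatic; these copies share a colour μ, which also
-- occurs in every other copy.  At most two copies contain vertices of another
-- colour.  Either the induction hypothesis applies to such a copy, or so few
-- faults lie outside that some such vertex has a non-faulty neighbour in a
-- copy of colour μ.  For n = 4 the copies are triangles, and it suffices to
-- count the pairs of copies between which the only edge is destroyed.
module Submission where

open import Defs
open import Data.Bool using (Bool; true; false; _∧_; if_then_else_; T)
open import Data.Empty using (⊥; ⊥-elim)
open import Data.Fin using (Fin; zero; suc; toℕ)
import Data.Fin.Properties as Fin
open import Data.List using (List; []; _∷_; length; map; filter; _++_; cartesianProduct; allFin)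
open import Data.List.Properties using (length-map; length-++; length-tabulate; map-tabulate; filter-notAll; filter-reject)
open import Data.List.Membership.Propositional using (_∈_; _∉_; find)
open import Data.List.Membership.Propositional.Properties
  using (∈-filter⁺; ∈-filter⁻; ∈-map⁺; ∈-map⁻; ∈-++⁺ˡ; ∈-++⁺ʳ; ∈-++⁻; ∈-cartesianProduct⁻; ∈-length; ∈-allFin)
open import Data.List.Relation.Binary.Subset.Propositional using (_⊆_)
open import Data.List.Relation.Unary.All as All using (All; []; _∷_)
open import Data.List.Relation.Unary.All.Properties using (¬All⇒Any¬)
open import Data.List.Relation.Unary.AllPairs using (AllPairs; []; _∷_)
import Data.List.Relation.Unary.AllPairs.Properties as AllPairs
open import Data.List.Relation.Unary.Any as Any using (here; there)
open import Data.List.Relation.Unary.Unique.Propositional using (Unique)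
import Data.List.Relation.Unary.Unique.Propositional.Properties as Unique
open import Data.Nat
  using (ℕ; zero; suc; _+_; _*_; _∸_; _≤_; _<_; z≤n; s≤s; s≤s⁻¹; _≤?_; _<ᵇ_; parity)
open import Data.Nat.Divisibility using (_∣_; divides; divides-refl)
open import Data.Nat.ListAction using (sum)
open import Data.Nat.Properties hiding (_≟_)
import Data.Nat.Properties as ℕ using (_≟_)
open import Data.Parity using (Parity; 0ℙ; 1ℙ; _⁻¹) renaming (_+_ to _⊕_)
import Data.Parity.Properties as ℙ
open import Data.Product using (Σ; ∃; ∃₂; _×_; _,_; proj₁; proj₂; swap)
open import Data.Product.Properties using (≡-dec)
open import Data.Sum as Sum using (_⊎_; inj₁; inj₂)
open import Data.Vec using (Vec; []; _∷_; lookup; _[_]≔_)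
import Data.Vec as Vec
import Data.Vec.Properties as Vec
open import Data.Vec.Relation.Unary.All using ([]; _∷_)
import Data.Vec.Relation.Unary.All as VecAll
import Data.Vec.Relation.Unary.All.Properties as VecAll
open import Data.Vec.Relation.Unary.AllPairs using ([]; _∷_)
import Data.Vec.Relation.Unary.Unique.Propositional as Vec using (Unique)
import Data.Vec.Relation.Unary.Unique.Propositional.Properties as VecUnique
open import Function using (_∘_; id)
open import Level using (0ℓ)
open import Relation.Binary using (DecidableEquality; tri<; tri≈; tri>)
open import Relation.Binary.PropositionalEquality
  using (_≡_; _≢_; refl; sym; trans; cong; cong₂; subst; module ≡-Reasoning)
open import Relation.Nullary using (¬_; Dec; yes; no; contradiction; ¬¬-excluded-middle)
open import Relation.Nullary.Decidable using (¬?; _⊎-dec_)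
open import Relation.Unary using (Pred; Decidable)

-- Counting in lists

count : ∀ {A : Set} {P : Pred A 0ℓ} → Decidable P → List A → ℕ
count P? xs = length (filter P? xs)

module _ {A : Set} {P Q : Pred A 0ℓ} (P? : Decidable P) (Q? : Decidable Q) where

  count-mono : (∀ {x} → P x → Q x) → ∀ xs → count P? xs ≤ count Q? xs
  count-mono P⊆Q [] = z≤n
  count-mono P⊆Q (x ∷ xs) with P? x | Q? x
  ... | yes _ | yes _ = s≤s (count-mono P⊆Q xs)
  ... | yes p | no ¬q = contradiction (P⊆Q p) ¬q
  ... | no _  | yes _ = m≤n⇒m≤1+n (count-mono P⊆Q xs)
  ... | no _  | no _  = count-mono P⊆Q xs

  count-disjoint : (∀ {x} → P x → ¬ Q x) → ∀ xs → count P? xs + count Q? xs ≤ length xs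
  count-disjoint P#Q [] = z≤n
  count-disjoint P#Q (x ∷ xs) with P? x | Q? x
  ... | yes p | yes q = contradiction q (P#Q p)
  ... | yes _ | no _  = s≤s (count-disjoint P#Q xs)
  ... | no _  | yes _ = ≤-trans (≤-reflexive (+-suc _ _)) (s≤s (count-disjoint P#Q xs))
  ... | no _  | no _  = m≤n⇒m≤1+n (count-disjoint P#Q xs)

nonempty : ∀ {A : Set} {xs : List A} → 0 < length xs → ∃ (_∈ xs)
nonempty {xs = x ∷ _} _ = x , here refl

module Finite {A : Set} (_≟_ : DecidableEquality A) where

  open import Data.List.Membership.DecPropositional _≟_ using (_∈?_)

  infixl 6 _-_
  _-_ : List A → A → List A
  xs - x = filter (λ y → ¬? (y ≟ x)) xs

  ∈-- : ∀ {xs x y} → y ∈ xs → y ≢ x → y ∈ xs - x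
  ∈-- = ∈-filter⁺ _

  ∈--⁻ : ∀ {xs x y} → y ∈ xs - x → y ∈ xs × y ≢ x
  ∈--⁻ {xs} = ∈-filter⁻ _ {xs = xs}

  unique-- : ∀ {xs x} → Unique xs → Unique (xs - x)
  unique-- = Unique.filter⁺ _

  unique⊆⇒length≤ : ∀ {xs ys} → Unique xs → xs ⊆ ys → length xs ≤ length ys
  unique⊆⇒length≤ {[]} _ _ = z≤n
  unique⊆⇒length≤ {x ∷ xs} {ys} (x∉xs ∷ uxs) xs⊆ys =
    ≤-<-trans (unique⊆⇒length≤ uxs λ y∈xs → ∈-- (xs⊆ys (there y∈xs)) (All.lookup x∉xs y∈xs ∘ sym))
              (filter-notAll _ ys (Any.map (λ x≡y y≢x → y≢x (sym x≡y)) (xs⊆ys (here refl))))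

  length≤1+length-- : ∀ {xs} x → Unique xs → length xs ≤ suc (length (xs - x))
  length≤1+length-- {xs} x uxs = unique⊆⇒length≤ uxs xs⊆
    where
    xs⊆ : xs ⊆ x ∷ (xs - x)
    xs⊆ {y} y∈xs with y ≟ x
    ... | yes y≡x = here y≡x
    ... | no  y≢x = there (∈-- y∈xs y≢x)

  ∃∉ : ∀ {xs} ys → Unique xs → length ys < length xs → ∃ λ x → x ∈ xs × x ∉ ys
  ∃∉ {xs} ys uxs ys<xs with Any.any? (λ x → ¬? (x ∈? ys)) xs
  ... | yes p = find p
  ... | no ¬p = contradiction (unique⊆⇒length≤ uxs xs⊆ys) (<⇒≱ ys<xs)
    where
    xs⊆ys : xs ⊆ ys
    xs⊆ys {x} x∈xs with x ∈? ys
    ... | yes x∈ys = x∈ys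
    ... | no  x∉ys = contradiction (Any.map (λ { refl → x∉ys }) x∈xs) ¬p

  module _ {B : Set} (g : B → A) where

    fibre? : ∀ k → Decidable (λ b → g b ≡ k)
    fibre? k b = g b ≟ k

    fibres≤length : ∀ {ks} → Unique ks → ∀ bs → sum (map (λ k → count (fibre? k) bs) ks) ≤ length bs
    fibres≤length [] bs = z≤n
    fibres≤length {k ∷ ks} (k∉ks ∷ uks) bs = ≤-trans
      (+-monoʳ-≤ (count (fibre? k) bs) (≤-trans (go k∉ks) (fibres≤length uks rest)))
      (count-disjoint (fibre? k) (λ b → ¬? (fibre? k b)) (λ p ¬p → ¬p p) bs)
      where
      rest = filter (λ b → ¬? (fibre? k b)) bs
      keep : ∀ {l} → k ≢ l → ∀ bs → count (fibre? l) bs ≤ count (fibre? l) (filter (λ b → ¬? (fibre? k b)) bs)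
      keep k≢l [] = z≤n
      keep {l} k≢l (b ∷ bs) with g b ≟ k
      ... | yes gb≡k rewrite filter-reject (fibre? l) {xs = bs} (λ gb≡l → k≢l (trans (sym gb≡k) gb≡l)) = keep k≢l bs
      ... | no _ with g b ≟ l
      ...   | yes _ = s≤s (keep k≢l bs)
      ...   | no  _ = keep k≢l bs
      go : ∀ {ls} → All (k ≢_) ls →
           sum (map (λ l → count (fibre? l) bs) ls) ≤ sum (map (λ l → count (fibre? l) rest) ls)
      go []         = z≤n
      go (k≢l ∷ ps) = +-mono-≤ (keep k≢l bs) (go ps)

    -- The fibres over distinct keys are disjoint. Every use is a pigeonhole argument: with fewer
    -- than `length ks * q` faults, some key has fewer than `q` of them in its fibre.
    packing : ∀ {ks q} bs → Unique ks → All (λ k → q ≤ count (fibre? k) bs) ks → length ks * q ≤ length bs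
    packing {q = q} bs uks qs = ≤-trans (go qs) (fibres≤length uks bs)
      where
      go : ∀ {ks} → All (λ k → q ≤ count (fibre? k) bs) ks →
           length ks * q ≤ sum (map (λ k → count (fibre? k) bs) ks)
      go []       = z≤n
      go (p ∷ ps) = +-mono-≤ p (go ps)

-- The star graph

module Star {X : Set} (_≟_ : DecidableEquality X) where

  open Finite _≟_ public

  private variable
    k m : ℕ
    L : List X
    c x y z : X

  -- The alphabet is a list, not the whole type, because fixing a symbol `x` leads to a star graph
  -- over the smaller alphabet `L - x`.
  Ok : List X → Vec X k → Set
  Ok L t = VecAll.All (_∈ L) t × Vec.Unique t

  rename : X → X → X → X
  rename y c z with z ≟ y
  ... | yes _ = c
  ... | no  _ = z

  -- The edges of the (n,k)-star graph all have this form: y replaces the head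
  -- c, and if y already occurred in the tuple, then c takes its place.
  nb : X → Vec X (suc k) → Vec X (suc k)
  nb y (c ∷ r) = y ∷ Vec.map (rename y c) r

  rename-≢ : z ≢ y → rename y c z ≡ z
  rename-≢ {z} {y} z≢y with z ≟ y
  ... | yes z≡y = contradiction z≡y z≢y
  ... | no  _   = refl

  rename-≡ : ∀ y {c} → rename y c y ≡ c
  rename-≡ y with y ≟ y
  ... | yes _   = refl
  ... | no  y≢y = contradiction refl y≢y

  map-rename-≢ : ∀ {r : Vec X k} → VecAll.All (y ≢_) r → Vec.map (rename y c) r ≡ r
  map-rename-≢ []       = refl
  map-rename-≢ (p ∷ ps) = cong₂ _∷_ (rename-≢ (p ∘ sym)) (map-rename-≢ ps)

  map-rename-all : {P : Pred X 0ℓ} {r : Vec X k} → P c → VecAll.All P r → VecAll.All P (Vec.map (rename y c) r)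
  map-rename-all pc [] = []
  map-rename-all {y = y} {r = z ∷ _} pc (pz ∷ ps) with z ≟ y
  ... | yes _ = pc ∷ map-rename-all pc ps
  ... | no  _ = pz ∷ map-rename-all pc ps

  private
    ≢-rename : y ≢ c → y ≢ rename y c z
    ≢-rename {y} {z = z} y≢c eq with z ≟ y
    ... | yes _   = y≢c eq
    ... | no  z≢y = z≢y (sym eq)

    rename-injective : ∀ {z z′} → c ≢ z → c ≢ z′ → rename y c z ≡ rename y c z′ → z ≡ z′
    rename-injective {y = y} {z = z} {z′} c≢z c≢z′ eq with z ≟ y | z′ ≟ y
    ... | yes p | yes q = trans p (sym q)
    ... | yes _ | no  _ = contradiction eq c≢z′
    ... | no  _ | yes _ = contradiction (sym eq) c≢z
    ... | no  _ | no  _ = eq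

    -- Sending `y` to `c` is injective on symbols other than `c`, and `c` does not occur in `r`.
    unique-rename : {r : Vec X k} → VecAll.All (c ≢_) r → Vec.Unique r → Vec.Unique (Vec.map (rename y c) r)
    unique-rename {r = []} _ _ = []
    unique-rename {c = c} {y = y} {r = _ ∷ r} (p ∷ ps) (u ∷ us) = go ps u ∷ unique-rename ps us
      where
      go : ∀ {j} {r : Vec X j} → VecAll.All (c ≢_) r → VecAll.All (_ ≢_) r →
           VecAll.All (_ ≢_) (Vec.map (rename y c) r)
      go [] [] = []
      go (p′ ∷ ps) (v ∷ vs) = (v ∘ rename-injective p p′) ∷ go ps vs

    ≢-map-rename : (r : Vec X k) → y ≢ c → VecAll.All (y ≢_) (Vec.map (rename y c) r)
    ≢-map-rename []      y≢c = []
    ≢-map-rename (z ∷ r) y≢c = ≢-rename y≢c ∷ ≢-map-rename r y≢c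

  nb-ok : {t : Vec X (suc k)} → Ok L t → y ∈ L → y ≢ Vec.head t → Ok L (nb y t)
  nb-ok {t = c ∷ r} (c∈L ∷ r∈L , c≢r ∷ ur) y∈L y≢c =
    (y∈L ∷ map-rename-all c∈L r∈L) , (≢-map-rename r y≢c ∷ unique-rename c≢r ur)

  ok-∷ : {t : Vec X k} → x ∈ L → Ok (L - x) t → Ok L (x ∷ t)
  ok-∷ {L = L} x∈L (t∈ , ut) =
    (x∈L ∷ VecAll.map (proj₁ ∘ ∈--⁻ {L}) t∈) , (VecAll.map (λ p → proj₂ (∈--⁻ {L} p) ∘ sym) t∈ ∷ ut)

  ok-∷⁻ : {t : Vec X k} → Ok L (x ∷ t) → x ∈ L × Ok (L - x) t
  ok-∷⁻ (x∈L ∷ t∈L , x≢t ∷ ut) =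
    x∈L , VecAll.map (λ { (z∈L , x≢z) → ∈-- z∈L (x≢z ∘ sym) }) (VecAll.zip (t∈L , x≢t)) , ut

  ok-swap : {r : Vec X k} → Ok L (x ∷ y ∷ r) → Ok L (y ∷ x ∷ r)
  ok-swap (x∈L ∷ y∈L ∷ r∈L , (x≢y ∷ x≢r) ∷ y≢r ∷ ur) =
    (y∈L ∷ x∈L ∷ r∈L) , ((x≢y ∘ sym) ∷ y≢r) ∷ x≢r ∷ ur

  ∃-ok : ∀ k {L} → Unique L → k ≤ length L → ∃ λ (t : Vec X k) → Ok L t
  ∃-ok zero _ _ = [] , ([] , [])
  ∃-ok (suc k) {x ∷ L} (x∉L ∷ uL) (s≤s k≤L) =
    let t , t∈ , ut = ∃-ok k uL k≤L in
    x ∷ t , (here refl ∷ VecAll.map there t∈) , (VecAll.map (All.lookup x∉L) t∈ ∷ ut)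

  ∃-ok₂ : ∀ k {L} → Unique L → 2 + k ≤ length L → x ∈ L → y ∈ L - x → ∃ λ (r : Vec X k) → Ok L (x ∷ y ∷ r)
  ∃-ok₂ {x = x} {y} k {L} uL k≤ x∈ y∈ =
    let r , okr = ∃-ok k (unique-- (unique-- uL))
                    (s≤s⁻¹ (s≤s⁻¹ (≤-trans k≤ (≤-trans (length≤1+length-- x uL) (s≤s (length≤1+length-- y (unique-- uL)))))))
    in r , ok-∷ x∈ (ok-∷ y∈ okr)

  -- Copies given by the second symbol

  second : Vec X (2 + k) → X
  second (_ ∷ x ∷ _) = x

  ends : Vec X (2 + k) → X × X
  ends t = Vec.head t , second t

  -- Deleting the second symbol turns the copy of `x` into the star graph on tuples over `L - x`
  -- with one entry fewer; `ins x` is the inverse.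
  del : Vec X (2 + k) → Vec X (1 + k)
  del (c ∷ _ ∷ r) = c ∷ r

  ins : X → Vec X (1 + k) → Vec X (2 + k)
  ins x (c ∷ r) = c ∷ x ∷ r

  ins-del : (t : Vec X (2 + k)) → ins (second t) (del t) ≡ t
  ins-del (_ ∷ _ ∷ _) = refl

  second? : ∀ x → Decidable (λ (t : Vec X (2 + k)) → second t ≡ x)
  second? = fibre? second

  slice : X → List (Vec X (2 + k)) → List (Vec X (1 + k))
  slice x F = map del (filter (second? x) F)

  length-slice : ∀ x (F : List (Vec X (2 + k))) → length (slice x F) ≡ count (second? x) F
  length-slice x F = length-map del (filter (second? x) F)

  ∈-slice : {F : List (Vec X (2 + k))} {t : Vec X (1 + k)} → ins x t ∈ F → t ∈ slice x F
  ∈-slice {x = x} {t = _ ∷ _} p = ∈-map⁺ del (∈-filter⁺ (second? x) p refl)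

  ∈-slice⁻ : {F : List (Vec X (2 + k))} {t : Vec X (1 + k)} → t ∈ slice x F → ins x t ∈ F
  ∈-slice⁻ {x = x} {F = F} p with ∈-map⁻ del p
  ... | f , f∈ , refl with ∈-filter⁻ (second? x) {xs = F} f∈
  ...   | f∈F , refl = subst (_∈ F) (sym (ins-del f)) f∈F

  -- Colourings and their restriction to copies

  Live : List X → List (Vec X k) → Vec X k → Set
  Live L F t = Ok L t × t ∉ F

  Colouring : List X → List (Vec X (suc k)) → (Vec X (suc k) → ℕ) → Set
  Colouring L F χ = ∀ t {y} → Live L F t → y ∈ L → y ≢ Vec.head t → nb y t ∉ F → χ t ≡ χ (nb y t)

  -- Lists of non-faulty tuples with pairwise distinct colours are bounded, so the set of colours
  -- itself never has to be formed.
  AtMost : ℕ → List X → List (Vec X (suc k)) → (Vec X (suc k) → ℕ) → Set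
  AtMost j L F χ = ∀ {ts} → All (Live L F) ts → Unique (map χ ts) → length ts ≤ j

  -- The edge with `y ≡ x` is the only one that leaves the copy of `x`; it exchanges the first two
  -- symbols.
  nb-second : {r : Vec X k} → Ok L (c ∷ x ∷ r) → nb x (c ∷ x ∷ r) ≡ x ∷ c ∷ r
  nb-second {c = c} {x = x} (_ , _ ∷ x≢r ∷ _) = cong (x ∷_) (cong₂ _∷_ (rename-≡ x) (map-rename-≢ x≢r))

  nb-ins : (t : Vec X (suc k)) → x ≢ y → nb y (ins x t) ≡ ins x (nb y t)
  nb-ins (c ∷ r) x≢y = cong (λ z → _ ∷ z ∷ _) (rename-≢ x≢y)

  alive-ins : {F : List (Vec X (2 + k))} {t : Vec X (1 + k)} →
              x ∈ L → Live (L - x) (slice x F) t → Live L F (ins x t)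
  alive-ins {t = _ ∷ _} x∈L (ok , t∉) = ok-swap (ok-∷ x∈L ok) , t∉ ∘ ∈-slice

  alive-del : {F : List (Vec X (2 + k))} {t : Vec X (1 + k)} →
              Live L F (ins x t) → x ∈ L × Live (L - x) (slice x F) t
  alive-del {t = _ ∷ _} (ok , t∉) =
    let x∈L , ok′ = ok-∷⁻ (ok-swap ok) in x∈L , ok′ , t∉ ∘ ∈-slice⁻

  module _ {F : List (Vec X (2 + k))} {χ : Vec X (2 + k) → ℕ} (col : Colouring L F χ) where

    along : ∀ {t t′} → Live L F t → y ∈ L → y ≢ Vec.head t → nb y t ≡ t′ → t′ ∉ F → χ t ≡ χ t′
    along a y∈L y≢c refl ∉F = col _ a y∈L y≢c ∉F

    cross : {r : Vec X k} → Live L F (c ∷ x ∷ r) → x ∷ c ∷ r ∉ F → χ (c ∷ x ∷ r) ≡ χ (x ∷ c ∷ r)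
    cross a@(ok@(_ ∷ x∈L ∷ _ , (c≢x ∷ _) ∷ _) , _) = along a x∈L (c≢x ∘ sym) (nb-second ok)

    -- By `nb-ins`, edges of the smaller star graph are edges inside the copy of `x`. This makes the
    -- induction hypothesis applicable to copies.
    colouring-slice : x ∈ L → Colouring (L - x) (slice x F) (χ ∘ ins x)
    colouring-slice {x = x} x∈L (c ∷ r) a y∈ y≢c nb∉ =
      let y∈L , y≢x = ∈--⁻ {L} y∈ in
      along (alive-ins x∈L a) y∈L y≢c (nb-ins (c ∷ r) (y≢x ∘ sym)) (nb∉ ∘ ∈-slice)

  -- For n = 3 + m the bounds on the number of faults are n-2, 2n-4 and 3n-7.
  record Bounds (m : ℕ) : Set where
    field
      one   : ∀ {L F} {χ : Vec X (suc m) → ℕ} → Unique L → 3 + m ≤ length L → Colouring L F χ →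
              length F < 2 + m → AtMost 1 L F χ
      two   : ∀ {L F} {χ : Vec X (suc m) → ℕ} → Unique L → 3 + m ≤ length L → Colouring L F χ →
              2 + length F ≤ 2 * (2 + m) → AtMost 2 L F χ
      three : ∀ {L F} {χ : Vec X (suc m) → ℕ} → Unique L → 3 + m ≤ length L → Colouring L F χ →
              4 + length F ≤ 3 * (2 + m) → AtMost 3 L F χ

  -- Base case: two symbols per tuple

  private
    Linked : List (X × X) → X → X → Set
    Linked G p q = (p , q) ∈ G ⊎ (q , p) ∈ G

    -- Together with the diagonal, G and its transpose cover all 16 pairs.
    six-edges : ∀ {a b c d G} → let ks = a ∷ b ∷ c ∷ d ∷ [] in
                Unique ks → AllPairs (Linked G) ks → 6 ≤ length G
    six-edges {a} {b} {c} {d} {G} uks ps = ≮⇒≥ λ G<6 → n≮n 15 (≤-trans bound (small G<6))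
      where
      ks = a ∷ b ∷ c ∷ d ∷ []
      cover = G ++ map swap G ++ map (λ x → x , x) ks
      linked : ∀ {ks p q} → AllPairs (Linked G) ks → p ∈ ks → q ∈ ks → p ≡ q ⊎ Linked G p q
      linked (_ ∷ _) (here refl) (here refl) = inj₁ refl
      linked (r ∷ _) (here refl) (there q∈)  = inj₂ (All.lookup r q∈)
      linked (r ∷ _) (there p∈)  (here refl) = inj₂ (Sum.swap (All.lookup r p∈))
      linked (_ ∷ s) (there p∈)  (there q∈)  = linked s p∈ q∈
      covers : cartesianProduct ks ks ⊆ cover
      covers {p , q} pq∈ with ∈-cartesianProduct⁻ ks ks pq∈
      ... | p∈ , q∈ with linked ps p∈ q∈
      ...   | inj₁ refl        = ∈-++⁺ʳ G (∈-++⁺ʳ (map swap G) (∈-map⁺ _ p∈))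
      ...   | inj₂ (inj₁ pq∈G) = ∈-++⁺ˡ pq∈G
      ...   | inj₂ (inj₂ qp∈G) = ∈-++⁺ʳ G (∈-++⁺ˡ (∈-map⁺ swap qp∈G))
      bound : 16 ≤ length G + (length G + 4)
      bound = ≤-trans (Finite.unique⊆⇒length≤ (≡-dec _≟_ _≟_) (Unique.cartesianProduct⁺ uks uks) covers)
                      (≤-reflexive (trans (length-++ G) (cong (length G +_)
                        (trans (length-++ (map swap G)) (cong (_+ 4) (length-map swap G))))))
      small : length G < 6 → length G + (length G + 4) ≤ 15
      small (s≤s G≤5) = ≤-trans (+-mono-≤ G≤5 (+-monoˡ-≤ 4 G≤5)) (n≤1+n 14)

  -- With two symbols per tuple every copy is a triangle, so all the alive
  -- vertices of a copy have the same colour.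
  module Base {L F} {χ : Vec X 2 → ℕ} (uL : Unique L) (4≤L : 4 ≤ length L) (col : Colouring L F χ) where

    private
      open import Data.List.Membership.DecPropositional (Vec.≡-dec {n = 2} _≟_) using () renaming (_∈?_ to _∈ᵗ?_)

      Hit : X → X → Set
      Hit x y = (x ∷ y ∷ []) ∈ F ⊎ (y ∷ x ∷ []) ∈ F

      hit? : ∀ x y → Dec (Hit x y)
      hit? x y = ((x ∷ y ∷ []) ∈ᵗ? F) ⊎-dec ((y ∷ x ∷ []) ∈ᵗ? F)

      hit⇒linked : ∀ {x y} Ex → Hit x y → Linked (map ends F ++ Ex) x y
      hit⇒linked Ex = Sum.map (∈-++⁺ˡ ∘ ∈-map⁺ _) (∈-++⁺ˡ ∘ ∈-map⁺ _)

      extra : ∀ {x y} Ex → Linked Ex x y → Linked (map ends F ++ Ex) x y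
      extra Ex = Sum.map (∈-++⁺ʳ _) (∈-++⁺ʳ _)

      triangle : ∀ {c k x} → Live L F (c ∷ x ∷ []) → Live L F (k ∷ x ∷ []) →
                 χ (c ∷ x ∷ []) ≡ χ (k ∷ x ∷ [])
      triangle {c} {k} {x} a (ok@(k∈L ∷ _ , (k≢x ∷ _) ∷ _) , k∉F) with k ≟ c
      ... | yes refl = refl
      ... | no  k≢c  = along col a k∈L k≢c (cong (λ z → k ∷ z ∷ []) (rename-≢ (k≢x ∘ sym))) k∉F

      ok₂ : ∀ {x y} → x ∈ L → y ∈ L → x ≢ y → Ok L (x ∷ y ∷ [])
      ok₂ x∈L y∈L x≢y = (x∈L ∷ y∈L ∷ []) , ((x≢y ∷ []) ∷ [] ∷ [])

      -- Both ends of the only edge between copies `k` and `x` are then non-faulty. Together with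
      -- the triangle on `x` it carries the colour of copy `x` into copy `k`.
      unhit : ∀ {c x k} → Live L F (c ∷ x ∷ []) → k ∈ L → k ≢ x → ¬ Hit k x →
              Live L F (x ∷ k ∷ []) × χ (c ∷ x ∷ []) ≡ χ (x ∷ k ∷ [])
      unhit {x = x} {k} a@((_ ∷ x∈L ∷ _ , _) , _) k∈L k≢x ¬hit =
        (ok₂ x∈L k∈L (k≢x ∘ sym) , ¬hit ∘ inj₂) , trans (triangle a a′) (cross col a′ (¬hit ∘ inj₂))
        where
        a′ : Live L F (k ∷ x ∷ [])
        a′ = ok₂ k∈L x∈L k≢x , ¬hit ∘ inj₁

      x≢y : ∀ {c d x y} → Live L F (c ∷ x ∷ []) → Live L F (d ∷ y ∷ []) →
            χ (c ∷ x ∷ []) ≢ χ (d ∷ y ∷ []) → x ≢ y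
      x≢y a b χ≢ refl = χ≢ (triangle a b)

      -- An intact edge between the two copies would give them the same colour.
      hit : ∀ {c d x y} → Live L F (c ∷ x ∷ []) → Live L F (d ∷ y ∷ []) →
            χ (c ∷ x ∷ []) ≢ χ (d ∷ y ∷ []) → Hit x y
      hit {x = x} {y} a@((_ ∷ x∈L ∷ _ , _) , _) b χ≢ with hit? x y
      ... | yes h = h
      ... | no ¬h =
        let a′ , eq = unhit b x∈L (x≢y a b χ≢) ¬h in contradiction (trans (triangle a a′) (sym eq)) χ≢

      -- If copy `k` had intact edges to both copies, it would pass the colour of `x` on to `y`.
      hit-or : ∀ {c d x y k} → Live L F (c ∷ x ∷ []) → Live L F (d ∷ y ∷ []) →
               χ (c ∷ x ∷ []) ≢ χ (d ∷ y ∷ []) → k ∈ L → k ≢ x → k ≢ y → ¬ Hit k x → Hit k y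
      hit-or {x = x} {y} {k} a b χ≢ k∈L k≢x k≢y ¬h with hit? k y
      ... | yes h = h
      ... | no ¬h′ =
        let a′ , eq  = unhit a k∈L k≢x ¬h
            b′ , eq′ = unhit b k∈L k≢y ¬h′
        in contradiction (trans eq (trans (triangle a′ b′) (sym eq′))) χ≢

      -- A fault destroys only the edge between the copies of its own two symbols. Pairs not known
      -- to be hit are listed in `Ex` as if they were faults, so faults and exceptions together must
      -- cover all six pairs.
      too-few : ∀ {a b c d} Ex → Unique (a ∷ b ∷ c ∷ d ∷ []) →
                AllPairs (Linked (map ends F ++ Ex)) (a ∷ b ∷ c ∷ d ∷ []) →
                6 ≤ length F + length Ex
      too-few Ex u ps = ≤-trans (six-edges u ps) (≤-reflexive
        (trans (length-++ (map ends F)) (cong (_+ length Ex) (length-map _ F))))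

    one : length F < 3 → AtMost 1 L F χ
    one F<3 {[]}     _ _ = z≤n
    one F<3 {_ ∷ []} _ _ = s≤s z≤n
    one F<3 {(_ ∷ x ∷ []) ∷ (_ ∷ y ∷ []) ∷ _} (a ∷ b ∷ _) ((χ≢ ∷ _) ∷ _)
      with ∃∉ (x ∷ y ∷ []) uL (≤-trans (s≤s (s≤s (s≤s z≤n))) 4≤L)
    ... | k , k∈L , k∉ with ∃∉ (k ∷ x ∷ y ∷ []) uL 4≤L
    ...   | l , l∈L , l∉ with exempt k∈L (k∉ ∘ here) (k∉ ∘ there ∘ here)
                            | exempt l∈L (l∉ ∘ there ∘ here) (l∉ ∘ there ∘ there ∘ here)
      where
      exempt : ∀ {k} → k ∈ L → k ≢ x → k ≢ y → ∃ λ e → (Hit k x ⊎ e ≡ x) × (Hit k y ⊎ e ≡ y)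
      exempt {k} k∈L k≢x k≢y with hit? k x
      ... | yes h = y , inj₁ h , inj₂ refl
      ... | no ¬h = x , inj₂ refl , inj₁ (hit-or a b χ≢ k∈L k≢x k≢y ¬h)
    ...     | e , kx , ky | e′ , lx , ly =
      ⊥-elim (<⇒≱ (+-monoˡ-< 3 F<3) (too-few Ex
        (((l∉ ∘ here) ∷ (l∉ ∘ there ∘ here) ∷ (l∉ ∘ there ∘ there ∘ here) ∷ []) ∷
         ((k∉ ∘ here) ∷ (k∉ ∘ there ∘ here) ∷ []) ∷ (x≢y a b χ≢ ∷ []) ∷ [] ∷ [])
        ((extra Ex (inj₁ (here refl)) ∷ link (there ∘ there ∘ here) lx ∷ link (there ∘ there ∘ here) ly ∷ []) ∷
         (link (there ∘ here) kx ∷ link (there ∘ here) ky ∷ []) ∷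
         (hit⇒linked Ex (hit a b χ≢) ∷ []) ∷ [] ∷ [])))
      where
      -- At most three pairs may be intact: the pair of `k` and `l`, one of the two joining `k` to
      -- `x` and `y`, and one of the two joining `l` to them. The remaining three are hit, but there
      -- are fewer than three faults.
      Ex = (l , k) ∷ (k , e) ∷ (l , e′) ∷ []
      link : ∀ {k x e} → (∀ {p} → p ≡ (k , e) → p ∈ Ex) → Hit k x ⊎ e ≡ x →
             Linked (map ends F ++ Ex) k x
      link i (inj₁ h)    = hit⇒linked Ex h
      link i (inj₂ refl) = extra Ex (inj₁ (i refl))

    two : length F ≤ 4 → AtMost 2 L F χ
    two F≤4 {[]}         _ _ = z≤n
    two F≤4 {_ ∷ []}     _ _ = s≤s z≤n
    two F≤4 {_ ∷ _ ∷ []} _ _ = s≤s (s≤s z≤n)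
    two F≤4 {(_ ∷ x ∷ []) ∷ (_ ∷ y ∷ []) ∷ (_ ∷ z ∷ []) ∷ _} (a ∷ b ∷ c ∷ _) ((ab ∷ ac ∷ _) ∷ (bc ∷ _) ∷ _)
      with ∃∉ (x ∷ y ∷ z ∷ []) uL 4≤L
    ... | k , k∈L , k∉ with exempt
      where
      exempt : ∃ λ e → (Hit k x ⊎ e ≡ x) × (Hit k y ⊎ e ≡ y) × (Hit k z ⊎ e ≡ z)
      exempt with hit? k x | hit? k y
      ... | no ¬h | _ = x , inj₂ refl , inj₁ (hit-or a b ab k∈L (k∉ ∘ here) (k∉ ∘ there ∘ here) ¬h) ,
                        inj₁ (hit-or a c ac k∈L (k∉ ∘ here) (k∉ ∘ there ∘ there ∘ here) ¬h)
      ... | yes h | no ¬h =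
        y , inj₁ h , inj₂ refl ,
        inj₁ (hit-or b c bc k∈L (k∉ ∘ there ∘ here) (k∉ ∘ there ∘ there ∘ here) ¬h)
      ... | yes h | yes h′ = z , inj₁ h , inj₁ h′ , inj₂ refl
    ...   | e , kx , ky , kz =
      ⊥-elim (<⇒≱ (s≤s (+-monoˡ-≤ 1 F≤4)) (too-few Ex
        (((k∉ ∘ here) ∷ (k∉ ∘ there ∘ here) ∷ (k∉ ∘ there ∘ there ∘ here) ∷ []) ∷
         (x≢y a b ab ∷ x≢y a c ac ∷ []) ∷ (x≢y b c bc ∷ []) ∷ [] ∷ [])
        ((link kx ∷ link ky ∷ link kz ∷ []) ∷
         (hit⇒linked Ex (hit a b ab) ∷ hit⇒linked Ex (hit a c ac) ∷ []) ∷
         (hit⇒linked Ex (hit b c bc) ∷ []) ∷ [] ∷ [])))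
      where
      -- The pairs among `x`, `y`, `z` are all hit, and by `hit-or` at most one edge from `k` to
      -- these copies is intact. That accounts for five faults.
      Ex = (k , e) ∷ []
      link : ∀ {x} → Hit k x ⊎ e ≡ x → Linked (map ends F ++ Ex) k x
      link (inj₁ h)    = hit⇒linked Ex h
      link (inj₂ refl) = extra Ex (inj₁ (here refl))

    three : length F ≤ 5 → AtMost 3 L F χ
    three F≤5 {[]}             _ _ = z≤n
    three F≤5 {_ ∷ []}         _ _ = s≤s z≤n
    three F≤5 {_ ∷ _ ∷ []}     _ _ = s≤s (s≤s z≤n)
    three F≤5 {_ ∷ _ ∷ _ ∷ []} _ _ = s≤s (s≤s (s≤s z≤n))
    three F≤5 {(_ ∷ _ ∷ []) ∷ (_ ∷ _ ∷ []) ∷ (_ ∷ _ ∷ []) ∷ (_ ∷ _ ∷ []) ∷ _} (a ∷ b ∷ c ∷ d ∷ _)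
      ((ab ∷ ac ∷ ad ∷ _) ∷ (bc ∷ bd ∷ _) ∷ (cd ∷ _) ∷ _) =
      ⊥-elim (<⇒≱ (s≤s (+-monoˡ-≤ 0 F≤5)) (too-few []
        ((x≢y a b ab ∷ x≢y a c ac ∷ x≢y a d ad ∷ []) ∷ (x≢y b c bc ∷ x≢y b d bd ∷ []) ∷ (x≢y c d cd ∷ []) ∷ [] ∷ [])
        ((link a b ab ∷ link a c ac ∷ link a d ad ∷ []) ∷ (link b c bc ∷ link b d bd ∷ []) ∷
         (link c d cd ∷ []) ∷ [] ∷ [])))
      where
      link : ∀ {c d x y} → Live L F (c ∷ x ∷ []) → Live L F (d ∷ y ∷ []) →
             χ (c ∷ x ∷ []) ≢ χ (d ∷ y ∷ []) → Linked (map ends F ++ []) x y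
      link a b χ≢ = hit⇒linked [] (hit a b χ≢)

  bounds-base : Bounds 1
  bounds-base = record
    { one   = λ uL 4≤L col F<3 → Base.one uL 4≤L col F<3
    ; two   = λ uL 4≤L col F≤ → Base.two uL 4≤L col (+-cancelˡ-≤ 2 _ _ F≤)
    ; three = λ uL 4≤L col F≤ → Base.three uL 4≤L col (+-cancelˡ-≤ 4 _ _ F≤)
    }

  -- Inductive step

  ext : Vec X (2 + k) → Vec X (2 + k)
  ext (c ∷ x ∷ r) = x ∷ c ∷ r

  ext-injective : {t u : Vec X (2 + k)} → ext t ≡ ext u → t ≡ u
  ext-injective {t = _ ∷ _ ∷ _} {_ ∷ _ ∷ _} refl = refl

  second-ext : (t : Vec X (2 + k)) → second (ext t) ≡ Vec.head t
  second-ext (_ ∷ _ ∷ _) = refl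

  head≢second : {t : Vec X (2 + k)} → Ok L t → Vec.head t ≢ second t
  head≢second {t = _ ∷ _ ∷ _} (_ , (c≢x ∷ _) ∷ _) = c≢x

  module Step {m} (ih : Bounds (suc m)) {L F} {χ : Vec X (3 + m) → ℕ}
              (uL : Unique L) (5+m≤L : 5 + m ≤ length L) (col : Colouring L F χ)
              (F<3q : length F < 3 * (3 + m)) where

    private
      open import Data.List.Membership.DecPropositional (Vec.≡-dec {n = 3 + m} _≟_) using () renaming (_∈?_ to _∈ᵗ?_)

      -- This is n - 2 for n = 5 + m. The induction hypothesis makes every copy with fewer than `q`
      -- faults monochromatic.
      q = 3 + m

      size : X → ℕ
      size x = count (second? x) F

      copy-≥ : ∀ x → 4 + m ≤ length (L - x)
      copy-≥ x = s≤s⁻¹ (≤-trans 5+m≤L (length≤1+length-- x uL))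

      InCopy : X → Vec X (3 + m) → Set
      InCopy x t = Live L F t × second t ≡ x

      in-copy : ∀ {j x ts} → AtMost j (L - x) (slice x F) (χ ∘ ins x) →
                All (InCopy x) ts → Unique (map χ ts) → length ts ≤ j
      in-copy {j} {x} {ts} atMost as us =
        subst (_≤ j) (length-map del ts) (atMost (alive as) (subst Unique (sym (colours as)) us))
        where
        alive : ∀ {ts} → All (InCopy x) ts → All (Live (L - x) (slice x F)) (map del ts)
        alive [] = []
        alive {(c ∷ _ ∷ r) ∷ _} ((a , refl) ∷ as) = proj₂ (alive-del {t = c ∷ r} a) ∷ alive as
        colours : ∀ {ts} → All (InCopy x) ts → map (χ ∘ ins x) (map del ts) ≡ map χ ts
        colours [] = refl
        colours {t ∷ _} ((_ , refl) ∷ as) = cong₂ _∷_ (cong χ (ins-del t)) (colours as)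

      good-mono : ∀ {x t u} → x ∈ L → size x < q → InCopy x t → InCopy x u → χ t ≡ χ u
      good-mono {x} {t} {u} x∈L good a b with χ t ℕ.≟ χ u
      ... | yes eq = eq
      ... | no  ≢  = contradiction
        (in-copy (Bounds.one ih (unique-- uL) (copy-≥ x) (colouring-slice col x∈L)
                                (subst (_< q) (sym (length-slice x F)) good))
                 (a ∷ b ∷ []) ((≢ ∷ []) ∷ [] ∷ []))
        λ { (s≤s ()) }

      three-colours : ∀ {x t u v} → x ∈ L → 2 + size x ≤ 2 * q → InCopy x t → InCopy x u → InCopy x v →
                      χ t ≢ χ u → χ t ≢ χ v → χ u ≢ χ v → ⊥
      three-colours {x} x∈L le a b c tu tv uv = 1+n≰n
        (in-copy (Bounds.two ih (unique-- uL) (copy-≥ x) (colouring-slice col x∈L)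
                                (subst (λ s → 2 + s ≤ 2 * q) (sym (length-slice x F)) le))
                 (a ∷ b ∷ c ∷ []) ((tu ∷ tv ∷ []) ∷ (uv ∷ []) ∷ [] ∷ []))

      four-colours : ∀ {x t u v w} → x ∈ L → 4 + size x ≤ 3 * q →
                     InCopy x t → InCopy x u → InCopy x v → InCopy x w →
                     Unique (map χ (t ∷ u ∷ v ∷ w ∷ [])) → ⊥
      four-colours {x} x∈L le a b c d us = 1+n≰n
        (in-copy (Bounds.three ih (unique-- uL) (copy-≥ x) (colouring-slice col x∈L)
                                  (subst (λ s → 4 + s ≤ 3 * q) (sym (length-slice x F)) le))
                 (a ∷ b ∷ c ∷ d ∷ []) us)

      -- An edge between the copies of `x` and `k` with both ends non-faulty.
      Open : X → X → Set
      Open x k = ∃ λ s → Live L F (k ∷ x ∷ s) × x ∷ k ∷ s ∉ F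

      -- Sorts the faults by copies, except that a fault in copy x or y is
      -- attributed to the copy of its external neighbour.
      side : X → X → Vec X (3 + m) → X
      side x y (c ∷ z ∷ _) with z ≟ x | z ≟ y
      ... | no _ | no _ = z
      ... | _    | _    = c

      side-far : ∀ {x y} c {z} s → z ≢ x → z ≢ y → side x y (c ∷ z ∷ s) ≡ z
      side-far {x} {y} c {z} s z≢x z≢y with z ≟ x | z ≟ y
      ... | no _    | no _    = refl
      ... | yes z≡x | _       = contradiction z≡x z≢x
      ... | no _    | yes z≡y = contradiction z≡y z≢y

      side-near : ∀ {x y} c {z} s → z ≡ x ⊎ z ≡ y → side x y (c ∷ z ∷ s) ≡ c
      side-near {x} {y} c {z} s p with z ≟ x | z ≟ y
      ... | yes _  | _      = refl
      ... | no _   | yes _  = refl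
      ... | no z≢x | no z≢y = contradiction p λ { (inj₁ z≡x) → z≢x z≡x ; (inj₂ z≡y) → z≢y z≡y }

      side? : ∀ x y k → Decidable (λ t → side x y t ≡ k)
      side? x y = fibre? (side x y)

      -- Both ends of every edge between copies `w` and `k` are attributed to `k`, so fewer than `q`
      -- faults can block these edges. Since `L - w - k` has at least `q` symbols, some `z` in it is
      -- the third symbol of none of those faults, and any completion after `z` gives an open edge.
      open-side : ∀ {x y k w} → k ≢ x → k ≢ y → k ∈ L → w ∈ L → w ≡ x ⊎ w ≡ y →
                  count (side? x y k) F < q → Open w k
      open-side {x} {y} {k} {w} k≢x k≢y k∈L w∈L w∈xy few =
        let z , z∈ , z∉ = ∃∉ (map third (filter (side? x y k) F)) uM
                               (≤-trans (s≤s (≤-reflexive (length-map third (filter (side? x y k) F)))) (≤-trans few M≥))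
            r , okr = ∃-ok₂ m (unique-- uL) (≤-trans (m≤n+m (2 + m) 2) (copy-≥ w)) (∈-- k∈L k≢w) z∈
            ok = ok-∷ w∈L okr
        in z ∷ r ,
           (ok-swap ok , λ f∈ → z∉ (∈-map⁺ third (∈-filter⁺ (side? x y k) f∈ (side-near k (z ∷ r) w∈xy)))) ,
           (λ f∈ → z∉ (∈-map⁺ third (∈-filter⁺ (side? x y k) f∈ (side-far w (z ∷ r) k≢x k≢y))))
        where
        third : Vec X (3 + m) → X
        third (_ ∷ _ ∷ z ∷ _) = z
        k≢w : k ≢ w
        k≢w refl = Sum.[ k≢x , k≢y ] w∈xy
        M = L - w - k
        uM : Unique M
        uM = unique-- (unique-- uL)
        M≥ : 3 + m ≤ length M
        M≥ = s≤s⁻¹ (≤-trans (copy-≥ w) (length≤1+length-- k (unique-- uL)))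

      -- At least three symbols differ from `x` and `y`. If each were attributed `q` faults, there
      -- would be `3 * q` of them. The case `x ≡ y` is included and serves to find `root`.
      hub : ∀ {x y} → x ∈ L → y ∈ L → ∃ λ k → k ∈ L × size k < q × Open x k × Open y k
      hub {x} {y} x∈L y∈L with All.all? (λ k → q ≤? count (side? x y k) F) (L - x - y)
      ... | yes all = contradiction
        (≤-trans (*-monoˡ-≤ q (≤-trans (m≤m+n 3 m) (s≤s⁻¹ (≤-trans (copy-≥ x) (length≤1+length-- y (unique-- uL))))))
                 (packing (side x y) F (unique-- (unique-- uL)) all))
        (<⇒≱ F<3q)
      ... | no ¬all with find (¬All⇒Any¬ (λ k → q ≤? count (side? x y k) F) (L - x - y) ¬all)
      ...   | k , k∈ , few =
        k , k∈L , ≤-<-trans (count-mono (second? k) (side? x y k) (λ {t} → far {t}) F) (≰⇒> few) ,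
        open-side k≢x k≢y k∈L x∈L (inj₁ refl) (≰⇒> few) , open-side k≢x k≢y k∈L y∈L (inj₂ refl) (≰⇒> few)
        where
        k≢y = proj₂ (∈--⁻ {L - x} k∈)
        k≢x = proj₂ (∈--⁻ {L} (proj₁ (∈--⁻ {L - x} k∈)))
        k∈L = proj₁ (∈--⁻ {L} (proj₁ (∈--⁻ {L - x} k∈)))
        far : ∀ {t} → second t ≡ k → side x y t ≡ k
        far {c ∷ _ ∷ s} refl = side-far c s k≢x k≢y

      open-colour : ∀ {x k} (o : Open x k) → let s = proj₁ o in
                    InCopy x (k ∷ x ∷ s) × InCopy k (x ∷ k ∷ s) × χ (k ∷ x ∷ s) ≡ χ (x ∷ k ∷ s)
      open-colour (s , a@(ok , _) , ∉F) = (a , refl) , ((ok-swap ok , ∉F) , refl) , cross col a ∉F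

      -- The hub copy is monochromatic and has an open edge to each of the two copies.
      joined : ∀ {x y} → x ∈ L → y ∈ L → ∃ λ t → ∃ λ u → InCopy x t × InCopy y u × χ t ≡ χ u
      joined x∈L y∈L =
        let k , k∈L , good , ox , oy = hub x∈L y∈L
            a , a′ , eq  = open-colour ox
            b , b′ , eq′ = open-colour oy
        in _ , _ , a , b , trans eq (trans (good-mono k∈L good a′ b′) (sym eq′))

      root : ∃ λ x → ∃ λ t → x ∈ L × size x < q × InCopy x t
      root =
        let a , a∈L , _ = ∃∉ [] uL (≤-trans (s≤s z≤n) 5+m≤L)
            k , k∈L , good , o , _ = hub a∈L a∈L
        in k , _ , k∈L , good , proj₁ (proj₂ (open-colour o))

      μ = χ (proj₁ (proj₂ root))

      -- `joined` links the copy of `x` to the copy of the root, which is monochromatic of colour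
      -- `μ`.
      main : ∀ {x} → x ∈ L → ∃ λ t → InCopy x t × χ t ≡ μ
      main x∈L =
        let _ , _ , x₀∈L , good , a = root
            t , _ , b , c , eq = joined x∈L x₀∈L
        in t , b , trans eq (good-mono x₀∈L good c a)

      Stray : Vec X (3 + m) → Set
      Stray t = Live L F t × χ t ≢ μ

      second∈ : ∀ {t} → Live L F t → second t ∈ L
      second∈ {_ ∷ _ ∷ _} ((_ ∷ x∈L ∷ _ , _) , _) = x∈L

      -- A copy with fewer faults is monochromatic, and by `main` its colour is `μ`.
      stray-bad : ∀ {t} → Stray t → q ≤ size (second t)
      stray-bad (a , ≢μ) = ≮⇒≥ λ good →
        let _ , b , eq = main (second∈ a) in ≢μ (trans (good-mono (second∈ a) good (a , refl) b) eq)

      stray-ext : ∀ {t} → Stray t → ext t ∉ F → Stray (ext t) × χ t ≡ χ (ext t)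
      stray-ext {_ ∷ _ ∷ _} (a@(ok , _) , ≢μ) ∉F = ((ok-swap ok , ∉F) , ≢μ ∘ trans eq) , eq
        where eq = cross col a ∉F

      outside? : ∀ x → Decidable (λ (t : Vec X (3 + m)) → second t ≢ x)
      outside? x t = ¬? (second? x t)

      size+outside≤ : ∀ x → size x + count (outside? x) F ≤ length F
      size+outside≤ x = count-disjoint (second? x) (outside? x) (λ p ¬p → ¬p p) F

      -- With fewer than `q` faults outside copy `x`, no other copy contains strays. So the external
      -- neighbour of a stray in copy `x` is a fault outside that copy, and `ext` is injective.
      strays-in-copy : ∀ {x ts} → All (λ t → Stray t × second t ≡ x) ts → Unique (map χ ts) →
                       count (outside? x) F < q → length ts ≤ count (outside? x) F
      strays-in-copy {x} {ts} ss us few =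
        ≤-trans (≤-reflexive (sym (length-map ext ts)))
                (Finite.unique⊆⇒length≤ (Vec.≡-dec _≟_) (Unique.map⁺ ext-injective (Unique.map⁻ us)) ⊆F)
        where
        ext∈F : ∀ {t} → Stray t → second t ≡ x → ext t ∈ filter (outside? x) F
        ext∈F {t@(c ∷ _ ∷ _)} s@(((_ , (c≢x ∷ _) ∷ _) , _) , _) refl with ext t ∈ᵗ? F
        ... | yes ∈F = ∈-filter⁺ (outside? x) ∈F c≢x
        ... | no  ∉F = contradiction
          (≤-trans (stray-bad (proj₁ (stray-ext s ∉F)))
                   (count-mono (second? c) (outside? x) (λ { refl → c≢x }) F))
          (<⇒≱ few)
        ⊆F : map ext ts ⊆ filter (outside? x) F
        ⊆F p with ∈-map⁻ ext p
        ... | t , t∈ , refl = let s , eq = All.lookup ss t∈ in ext∈F s eq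

      -- If all faults lie in copies x and z, then external neighbours of strays
      -- stay in these copies.  Hence all neighbours of w in copy z, and also the
      -- external neighbour of u, are faults: too many for copy z.
      no-stray-pair : ∀ {u w} → Stray u → Stray w → second u ≢ second w → χ u ≢ χ w →
                      length F ≤ size (second u) + size (second w) → size (second w) ≤ q → ⊥
      no-stray-pair {u@(c ∷ x ∷ s)} {w@(d ∷ z ∷ s′)} su@(au@(oku , _) , u≢μ) sw@(aw@(okw , _) , w≢μ) x≢z u≢w F≤ z≤q =
        1+n≰n (≤-trans (copy-≥ z) (≤-trans (unique⊆⇒length≤ (unique-- uL) L-z⊆)
          (≤-trans (≤-reflexive (length-map Vec.head (filter (second? z) F))) z≤q)))
        where
        z∈L : z ∈ L
        z∈L = second∈ aw
        cover : ∀ {f} → f ∈ F → second f ≡ x ⊎ second f ≡ z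
        cover {f} f∈F with second f ≟ x | second f ≟ z
        ... | yes p  | _      = inj₁ p
        ... | no _   | yes p  = inj₂ p
        ... | no f≢x | no f≢z = ⊥-elim (<⇒≱ (≤-trans (+-monoˡ-≤ (size x + size z) 1≤) total) F≤)
          where
          1≤ : 1 ≤ size (second f)
          1≤ = ∈-length (∈-filter⁺ (second? (second f)) f∈F refl)
          total : size (second f) + (size x + size z) ≤ length F
          total = ≤-trans (≤-reflexive (cong (λ n → size (second f) + (size x + n)) (sym (+-identityʳ (size z)))))
            (fibres≤length second ((f≢x ∷ f≢z ∷ []) ∷ (x≢z ∷ []) ∷ [] ∷ []) F)
        -- An external neighbour that is not a fault is again a stray, so its copy contains faults
        -- and is one of the two.
        heads : ∀ {t} → Stray t → Vec.head t ≡ x ⊎ Vec.head t ≡ z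
        heads {t} st with ext t ∈ᵗ? F
        ... | yes ∈F = subst (λ y → y ≡ x ⊎ y ≡ z) (second-ext t) (cover ∈F)
        ... | no  ∉F with nonempty (≤-trans (s≤s z≤n) (stray-bad (proj₁ (stray-ext st ∉F))))
        ...   | f , f∈ = let f∈F , eq = ∈-filter⁻ (second? (second (ext t))) {xs = F} f∈ in
          subst (λ y → y ≡ x ⊎ y ≡ z) (trans eq (second-ext t)) (cover f∈F)
        c≡z : c ≡ z
        c≡z with heads su
        ... | inj₁ c≡x = contradiction c≡x (head≢second oku)
        ... | inj₂ c≡z = c≡z
        head≡x : ∀ {t} → Stray t → second t ≡ z → Vec.head t ≡ x
        head≡x st@((ok , _) , _) refl with heads st
        ... | inj₁ h≡x = h≡x
        ... | inj₂ h≡z = contradiction h≡z (head≢second ok)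
        d≡x : d ≡ x
        d≡x = head≡x sw refl
        ext-u∈F : ext u ∈ F
        ext-u∈F with ext u ∈ᵗ? F
        ... | yes ∈F = ∈F
        -- Otherwise `ext u` would be a stray in copy `z`, which would then show `μ` and the colours
        -- of `u` and `w` with at most `q`, hence at most `2 * q - 2`, faults.
        ... | no  ∉F = let (a , ≢μ) , eq = stray-ext su ∉F
                           t , b , eqμ = main z∈L
                       in ⊥-elim (three-colours z∈L
                            (≤-trans (+-mono-≤ (s≤s (s≤s (z≤n {1 + m}))) z≤q) (≤-reflexive (cong (q +_) (sym (+-identityʳ q)))))
                            b (aw , refl) (a , c≡z)
                            (λ e → w≢μ (trans (sym e) eqμ)) (λ e → ≢μ (trans (sym e) eqμ)) (λ e → u≢w (trans eq (sym e))))
        -- The fault `ext u` has head `x`. For any other `y`, a non-faulty `nb y w` would be a stray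
        -- in copy `z` with head `y`, against `head≡x`.
        L-z⊆ : L - z ⊆ map Vec.head (filter (second? z) F)
        L-z⊆ {y} y∈ with y ≟ x
        ... | yes refl = ∈-map⁺ Vec.head (∈-filter⁺ (second? z) ext-u∈F c≡z)
        ... | no  y≢x with nb y w ∈ᵗ? F
        ...   | yes ∈F = ∈-map⁺ Vec.head (∈-filter⁺ (second? z) ∈F (rename-≢ (proj₂ (∈--⁻ {L} y∈) ∘ sym)))
        ...   | no  ∉F = contradiction (head≡x nb-stray (rename-≢ (y≢z ∘ sym))) y≢x
          where
          y∈L = proj₁ (∈--⁻ {L} y∈)
          y≢z = proj₂ (∈--⁻ {L} y∈)
          y≢d : y ≢ d
          y≢d y≡d = y≢x (trans y≡d d≡x)
          nb-stray : Stray (nb y w)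
          nb-stray = (nb-ok okw y∈L y≢d , ∉F) , λ e → w≢μ (trans (col w aw y∈L y≢d ∉F) e)

      -- Among tuples of distinct colours at most one has colour `μ`; the rest are strays.
      strays⇒atMost : ∀ {j} → (∀ {ts} → All Stray ts → Unique (map χ ts) → length ts ≤ j) → AtMost (suc j) L F χ
      strays⇒atMost {j} few {ts} as us =
        ≤-trans (≤-reflexive (sym (length-map χ ts)))
          (≤-trans (Finite.unique⊆⇒length≤ ℕ._≟_ us ⊆μ)
            (s≤s (≤-trans (≤-reflexive (length-map χ rest)) (few (strays as) (uniques us)))))
        where
        stray? : Decidable (λ t → χ t ≢ μ)
        stray? t = ¬? (χ t ℕ.≟ μ)
        rest = filter stray? ts
        ⊆μ : map χ ts ⊆ μ ∷ map χ rest
        ⊆μ p with ∈-map⁻ χ p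
        ... | t , t∈ , refl with χ t ℕ.≟ μ
        ...   | yes eq = here eq
        ...   | no  ≢  = there (∈-map⁺ χ (∈-filter⁺ stray? t∈ ≢))
        strays : All (Live L F) ts → All Stray rest
        strays as = All.tabulate λ t∈ → let t∈ts , ≢ = ∈-filter⁻ stray? {xs = ts} t∈ in All.lookup as t∈ts , ≢
        uniques : Unique (map χ ts) → Unique (map χ rest)
        uniques = AllPairs.map⁺ ∘ AllPairs.filter⁺ stray? ∘ AllPairs.map⁻

      outside≤ : ∀ x b → length F ≤ b + size x → count (outside? x) F ≤ b
      outside≤ x b F≤ = +-cancelˡ-≤ (size x) _ _
        (≤-trans (size+outside≤ x) (≤-trans F≤ (≤-reflexive (+-comm b (size x)))))

      two-copies≤ : ∀ {x z} → x ≢ z → size x + size z ≤ length F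
      two-copies≤ {x} {z} x≢z = count-disjoint (second? x) (second? z) (λ p p′ → x≢z (trans (sym p) p′)) F

      -- By `main` the copy also contains `μ`, so it would have three colours.
      pair-in-copy : ∀ {u v} → Stray u → Stray v → second u ≡ second v → χ u ≢ χ v →
                     2 + size (second u) ≤ 2 * q → ⊥
      pair-in-copy (au , u≢μ) (av , v≢μ) eq u≢v le =
        let t , b , t≡μ = main (second∈ au) in
        three-colours (second∈ au) le b (au , refl) (av , sym eq)
          (λ e → u≢μ (trans (sym e) t≡μ)) (λ e → v≢μ (trans (sym e) t≡μ)) u≢v

      -- The copy of a stray uses up all `q` faults, so none is left outside to block its external
      -- neighbour.
      strays≤0 : length F ≤ q → ∀ {ts} → All Stray ts → Unique (map χ ts) → length ts ≤ 0
      strays≤0 F≤q [] _ = z≤n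
      strays≤0 F≤q {t ∷ _} (s ∷ _) _ = contradiction
        (≤-trans (strays-in-copy ((s , refl) ∷ []) ([] ∷ []) (≤-<-trans outside (s≤s z≤n))) outside) 1+n≰n
        where
        outside : count (outside? (second t)) F ≤ 0
        outside = outside≤ (second t) 0 (≤-trans F≤q (stray-bad s))

      -- In a common copy, either the induction hypothesis forbids a third colour, or at most one
      -- fault lies outside, too few for two strays. In different copies, each has exactly `q`
      -- faults and no others exist, so `no-stray-pair` applies.
      pair : ∀ {u v} → length F ≤ 2 * q → Stray u → Stray v → χ u ≢ χ v → ⊥
      pair {u} {v} F≤2q su sv u≢v with second u ≟ second v | 2 + size (second u) ≤? 2 * q
      ... | yes eq | yes le = pair-in-copy su sv eq u≢v le
      ... | yes eq | no ¬le = 1+n≰n (≤-trans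
        (strays-in-copy ((su , refl) ∷ (sv , sym eq) ∷ []) ((u≢v ∷ []) ∷ [] ∷ []) (≤-<-trans outside (s≤s (s≤s z≤n)))) outside)
        where
        outside : count (outside? (second u)) F ≤ 1
        outside = outside≤ (second u) 1 (≤-trans F≤2q (s≤s⁻¹ (≰⇒> ¬le)))
      ... | no neq | _ = no-stray-pair su sv neq u≢v
        (≤-trans F≤q+q (+-mono-≤ (stray-bad su) (stray-bad sv)))
        (+-cancelˡ-≤ q _ _ (≤-trans (+-monoˡ-≤ _ (stray-bad su)) (≤-trans (two-copies≤ neq) F≤q+q)))
        where
        F≤q+q : length F ≤ q + q
        F≤q+q = ≤-trans F≤2q (≤-reflexive (cong (q +_) (+-identityʳ q)))

      -- If the induction hypothesis fails to apply, the common copy has at least `2 * q - 1`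
      -- faults. The copy of `w` has at least `q`, and fewer than `3 * q` in total leave exactly the
      -- situation of `no-stray-pair`.
      pair-and-one : ∀ {u v w} → Stray u → Stray v → Stray w → second u ≡ second v → second u ≢ second w →
                     χ u ≢ χ v → χ u ≢ χ w → ⊥
      pair-and-one {u} {v} {w} su sv sw eq neq u≢v u≢w with 2 + size (second u) ≤? 2 * q
      ... | yes le = pair-in-copy su sv eq u≢v le
      ... | no ¬le = no-stray-pair su sw neq u≢w (s≤s⁻¹ F<) (+-cancelˡ-≤ (2 * q) _ _ w≤)
        where
        2q≤ : 2 * q ≤ suc (size (second u))
        2q≤ = s≤s⁻¹ (≰⇒> ¬le)
        F< : length F < suc (size (second u) + size (second w))
        F< = ≤-trans F<3q (≤-trans (+-mono-≤ (stray-bad sw) 2q≤) (≤-reflexive (+-comm (size (second w)) _)))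
        w≤ : 2 * q + size (second w) ≤ 2 * q + q
        w≤ = ≤-trans (+-monoˡ-≤ _ 2q≤) (≤-trans (s≤s (two-copies≤ neq)) (≤-trans F<3q (≤-reflexive (+-comm q _))))

      -- Three different copies would need `3 * q` faults. If all strays share a copy, either it has
      -- four colours against the induction hypothesis or at most two faults lie outside it.
      triple : ∀ {u v w} → Stray u → Stray v → Stray w → Unique (map χ (u ∷ v ∷ w ∷ [])) → ⊥
      triple {u} {v} {w} su@(au , u≢μ) sv@(av , v≢μ) sw@(aw , w≢μ) us@((uv ∷ uw ∷ []) ∷ (vw ∷ []) ∷ _)
        with second u ≟ second v | second u ≟ second w | second v ≟ second w
      ... | yes e | no ne | _     = pair-and-one su sv sw e ne uv uw
      ... | no ne | yes e | _     = pair-and-one su sw sv e ne uw uv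
      ... | no ne | no _  | yes e = pair-and-one sv sw su e (ne ∘ sym) vw (uv ∘ sym)
      ... | no e₁ | no e₂ | no e₃ = <⇒≱ F<3q (packing second F ((e₁ ∷ e₂ ∷ []) ∷ (e₃ ∷ []) ∷ [] ∷ [])
        (stray-bad su ∷ stray-bad sv ∷ stray-bad sw ∷ []))
      ... | yes e | yes e′ | _ with 4 + size (second u) ≤? 3 * q
      ...   | yes le = let t , b , t≡μ = main (second∈ au) in
        four-colours (second∈ au) le b (au , refl) (av , sym e) (aw , sym e′)
          (((λ p → u≢μ (trans (sym p) t≡μ)) ∷ (λ p → v≢μ (trans (sym p) t≡μ)) ∷ (λ p → w≢μ (trans (sym p) t≡μ)) ∷ []) ∷ us)
      ...   | no ¬le = 1+n≰n (≤-trans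
        (strays-in-copy ((su , refl) ∷ (sv , sym e) ∷ (sw , sym e′) ∷ []) us (≤-<-trans outside (m≤m+n 3 m))) outside)
        where
        outside : count (outside? (second u)) F ≤ 2
        outside = outside≤ (second u) 2 (s≤s⁻¹ (≤-trans F<3q (s≤s⁻¹ (≰⇒> ¬le))))

    one : length F ≤ q → AtMost 1 L F χ
    one F≤q = strays⇒atMost (strays≤0 F≤q)

    two : length F ≤ 2 * q → AtMost 2 L F χ
    two F≤2q = strays⇒atMost λ where
      [] _                             → z≤n
      (_ ∷ []) _                       → s≤s z≤n
      (su ∷ sv ∷ _) ((u≢v ∷ _) ∷ _) → ⊥-elim (pair F≤2q su sv u≢v)

    three : AtMost 3 L F χ
    three = strays⇒atMost λ where
      [] _                 → z≤n
      (_ ∷ []) _           → s≤s z≤n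
      (_ ∷ _ ∷ []) _       → s≤s (s≤s z≤n)
      (su ∷ sv ∷ sw ∷ _) ((uv ∷ uw ∷ _) ∷ (vw ∷ _) ∷ _) →
        ⊥-elim (triple su sv sw ((uv ∷ uw ∷ []) ∷ (vw ∷ []) ∷ [] ∷ []))

  bounds-step : ∀ {m} → Bounds (suc m) → Bounds (2 + m)
  bounds-step {m} ih = record
    { one   = λ uL L≥ col F< → Step.one ih uL L≥ col (≤-trans F< 1+q≤3q) (s≤s⁻¹ F<)
    ; two   = λ uL L≥ col F≤ → let F≤2q = +-cancelˡ-≤ 2 _ _ (≤-trans F≤ (≤-reflexive (*-suc 2 (3 + m)))) in
                Step.two ih uL L≥ col (≤-<-trans F≤2q 2q<3q) F≤2q
    ; three = λ uL L≥ col F≤ →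
                Step.three ih uL L≥ col (+-cancelˡ-≤ 3 _ _ (≤-trans F≤ (≤-reflexive (*-suc 3 (3 + m)))))
    }
    where
    2q<3q : 2 * (3 + m) < 3 * (3 + m)
    2q<3q = *-monoˡ-< (3 + m) (n<1+n 2)
    1+q≤3q : 1 + (3 + m) ≤ 3 * (3 + m)
    1+q≤3q = ≤-<-trans (m≤m+n (3 + m) _) 2q<3q

  bounds : ∀ m → Bounds (suc m)
  bounds zero    = bounds-base
  bounds (suc m) = bounds-step (bounds m)

-- Parity of inversions

private variable
  k n : ℕ

bit : Bool → Parity
bit b = if b then 1ℙ else 0ℙ

_<ᶠ_ : Fin n → Fin n → Parity
y <ᶠ x = bit (toℕ y <ᵇ toℕ x)

below : Fin n → Vec (Fin n) k → Parity
below x []       = 0ℙ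
below x (y ∷ ys) = (y <ᶠ x) ⊕ below x ys

sgn : Vec (Fin n) k → Parity
sgn []       = 0ℙ
sgn (x ∷ xs) = below x xs ⊕ sgn xs

private
  -- The formula of `inversions` with the length separated from the number of symbols, so that
  -- induction can pass to the tail.
  inv : Vec (Fin n) k → ℕ
  inv {k = k} p = sum (map (λ i → sum (map (λ j →
    if (toℕ i <ᵇ toℕ j) ∧ (toℕ (lookup p j) <ᵇ toℕ (lookup p i)) then 1 else 0) (allFin k))) (allFin k))

  sum-allFin-suc : (f : Fin (suc k) → ℕ) →
                   sum (map f (allFin (suc k))) ≡ f zero + sum (map (f ∘ suc) (allFin k))
  sum-allFin-suc f = cong (λ l → f zero + sum l) (trans (map-tabulate suc f) (sym (map-tabulate id (f ∘ suc))))

  sum-cong : {f g : Fin k → ℕ} → (∀ i → f i ≡ g i) → ∀ is → sum (map f is) ≡ sum (map g is)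
  sum-cong f≗g []       = refl
  sum-cong f≗g (i ∷ is) = cong₂ _+_ (f≗g i) (sum-cong f≗g is)

  parity-bit : ∀ b → parity (if b then 1 else 0) ≡ bit b
  parity-bit false = refl
  parity-bit true  = refl

  parity-below : ∀ (x : Fin n) (xs : Vec (Fin n) k) →
    parity (sum (map (λ j → if toℕ (lookup xs j) <ᵇ toℕ x then 1 else 0) (allFin k))) ≡ below x xs
  parity-below x []       = refl
  parity-below x (y ∷ xs) = begin
    parity (sum (map f (allFin _)))                            ≡⟨ cong parity (sum-allFin-suc f) ⟩
    parity (f zero + sum (map (f ∘ suc) (allFin _)))           ≡⟨ ℙ.+-homo-+ (f zero) _ ⟩
    parity (f zero) ⊕ parity (sum (map (f ∘ suc) (allFin _)))  ≡⟨ cong₂ _⊕_ (parity-bit (toℕ y <ᵇ toℕ x)) (parity-below x xs) ⟩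
    (y <ᶠ x) ⊕ below x xs                                      ∎
    where
    open ≡-Reasoning
    f = λ j → if toℕ (lookup (y ∷ xs) j) <ᵇ toℕ x then 1 else 0

  parity-inv : (p : Vec (Fin n) k) → parity (inv p) ≡ sgn p
  parity-inv []       = refl
  parity-inv {k = suc k} (x ∷ xs) = begin
    parity (inv (x ∷ xs))                                                  ≡⟨ cong parity (sum-allFin-suc row) ⟩
    parity (row zero + sum (map (row ∘ suc) (allFin k)))                   ≡⟨ ℙ.+-homo-+ (row zero) _ ⟩
    parity (row zero) ⊕ parity (sum (map (row ∘ suc) (allFin k)))          ≡⟨ cong₂ _⊕_ first rest ⟩
    below x xs ⊕ sgn xs                                                    ∎
    where
    open ≡-Reasoning
    cell : Fin (suc k) → Fin (suc k) → ℕ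
    cell i j = if (toℕ i <ᵇ toℕ j) ∧ (toℕ (lookup (x ∷ xs) j) <ᵇ toℕ (lookup (x ∷ xs) i)) then 1 else 0
    row : Fin (suc k) → ℕ
    row i = sum (map (cell i) (allFin (suc k)))
    first : parity (row zero) ≡ below x xs
    first = trans (cong parity (sum-allFin-suc (cell zero))) (parity-below x xs)
    -- In each later row the cell in column zero computes to 0, so splitting it off leaves the row
    -- of the tail.
    rest : parity (sum (map (row ∘ suc) (allFin k))) ≡ sgn xs
    rest = trans (cong parity (sum-cong (λ i → sum-allFin-suc (cell (suc i))) (allFin k))) (parity-inv xs)

  2∣⇒parity : ∀ {n} → 2 ∣ n → parity n ≡ 0ℙ
  2∣⇒parity (divides-refl q) = go q
    where
    go : ∀ q → parity (q * 2) ≡ 0ℙ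
    go zero    = refl
    go (suc q) = go q

  parity⇒2∣ : ∀ n → parity n ≡ 0ℙ → 2 ∣ n
  parity⇒2∣ zero          _ = divides 0 refl
  parity⇒2∣ (suc (suc n)) e with parity⇒2∣ n e
  ... | divides q refl = divides (suc q) refl

even⇒sgn : (p : Vec (Fin n) n) → 2 ∣ inversions p → sgn p ≡ 0ℙ
even⇒sgn p even = trans (sym (parity-inv p)) (2∣⇒parity even)

sgn⇒even : (p : Vec (Fin n) n) → sgn p ≡ 0ℙ → 2 ∣ inversions p
sgn⇒even p e = parity⇒2∣ _ (trans (parity-inv p) e)

<ᶠ-flip : {a b : Fin n} → a ≢ b → a <ᶠ b ≡ (b <ᶠ a) ⁻¹
<ᶠ-flip {a = a} {b} a≢b with toℕ a <ᵇ toℕ b in eq | toℕ b <ᵇ toℕ a in eq′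
... | true  | false = refl
... | false | true  = refl
... | true  | true  = contradiction (<ᵇ⇒< _ _ (subst T (sym eq′) _)) (<-asym (<ᵇ⇒< (toℕ a) (toℕ b) (subst T (sym eq) _)))
... | false | false with <-cmp (toℕ a) (toℕ b)
...   | tri< a<b _ _ = contradiction (<⇒<ᵇ a<b) (subst T eq)
...   | tri≈ _ a≡b _ = contradiction (Fin.toℕ-injective a≡b) a≢b
...   | tri> _ _ b<a = contradiction (<⇒<ᵇ b<a) (subst T eq′)

private
  ⊕-swap : ∀ x y z → x ⊕ (y ⊕ z) ≡ y ⊕ (x ⊕ z)
  ⊕-swap x y z = trans (sym (ℙ.+-assoc x y z)) (trans (cong (_⊕ z) (ℙ.+-comm x y)) (ℙ.+-assoc y x z))

-- Only the comparison of `a` with `b` changes.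
sgn-swap : {a b : Fin n} (r : Vec (Fin n) k) → a ≢ b → sgn (b ∷ a ∷ r) ≡ sgn (a ∷ b ∷ r) ⁻¹
sgn-swap {a = a} {b} r a≢b = begin
  ((a <ᶠ b) ⊕ below b r) ⊕ (below a r ⊕ sgn r)      ≡⟨ cong (λ l → (l ⊕ below b r) ⊕ (below a r ⊕ sgn r)) (<ᶠ-flip a≢b) ⟩
  ((b <ᶠ a) ⁻¹ ⊕ below b r) ⊕ (below a r ⊕ sgn r)   ≡⟨ shuffle (b <ᶠ a) (below b r) (below a r) (sgn r) ⟩
  (((b <ᶠ a) ⊕ below a r) ⊕ (below b r ⊕ sgn r)) ⁻¹ ∎
  where
  open ≡-Reasoning
  shuffle : ∀ l x y z → (l ⁻¹ ⊕ x) ⊕ (y ⊕ z) ≡ ((l ⊕ y) ⊕ (x ⊕ z)) ⁻¹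
  shuffle 0ℙ x y z = trans (ℙ.+-assoc 1ℙ x (y ⊕ z)) (cong _⁻¹ (⊕-swap x y z))
  shuffle 1ℙ x y z = trans (⊕-swap x y z)
    (trans (sym (ℙ.⁻¹-involutive (y ⊕ (x ⊕ z)))) (cong _⁻¹ (sym (ℙ.+-assoc 1ℙ y (x ⊕ z)))))

private
  below-exchange : ∀ (b c : Fin n) (r : Vec (Fin n) k) i → below b (lookup r i ∷ (r [ i ]≔ c)) ≡ below b (c ∷ r)
  below-exchange b c (x ∷ r) zero    = ⊕-swap (x <ᶠ b) (c <ᶠ b) (below b r)
  below-exchange b c (x ∷ r) (suc i) =
    trans (⊕-swap (lookup r i <ᶠ b) (x <ᶠ b) _)
      (trans (cong ((x <ᶠ b) ⊕_) (below-exchange b c r i)) (⊕-swap (x <ᶠ b) (c <ᶠ b) _))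

  ⁻¹-cancel : ∀ x y → (x ⊕ y ⁻¹) ⁻¹ ≡ x ⊕ y
  ⁻¹-cancel 0ℙ y = ℙ.⁻¹-involutive y
  ⁻¹-cancel 1ℙ y = ℙ.⁻¹-involutive (y ⁻¹)

  sgn-∷-flip : ∀ (x : Fin n) (u v : Vec (Fin n) k) → below x u ≡ below x v → sgn u ≡ sgn v ⁻¹ →
               sgn (x ∷ u) ⁻¹ ≡ sgn (x ∷ v)
  sgn-∷-flip x u v eq flip = trans (cong _⁻¹ (cong₂ _⊕_ eq flip)) (⁻¹-cancel (below x v) (sgn v))

  -- Beyond position zero, swap the first two entries, exchange within the tail, and swap the first
  -- two back: three sign changes.
  sgn-exchange : ∀ {c : Fin n} (r : Vec (Fin n) k) i → Vec.Unique (c ∷ r) →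
                 sgn (lookup r i ∷ (r [ i ]≔ c)) ≡ sgn (c ∷ r) ⁻¹
  sgn-exchange (x ∷ r) zero ((c≢x ∷ _) ∷ _) = sgn-swap r c≢x
  sgn-exchange {c = c} (x ∷ r) (suc i) ((c≢x ∷ c≢r) ∷ x≢r ∷ ur) =
    trans (sgn-swap (r [ i ]≔ c) (VecAll.lookup⁺ x≢r i))
      (trans (sgn-∷-flip x (lookup r i ∷ (r [ i ]≔ c)) (c ∷ r) (below-exchange x c r i) (sgn-exchange r i (c≢r ∷ ur))) (sgn-swap r c≢x))

sgn-rot : {a b c : Fin n} (r : Vec (Fin n) k) → a ≢ c → b ≢ c → sgn (c ∷ a ∷ b ∷ r) ≡ sgn (a ∷ b ∷ c ∷ r)
sgn-rot {a = a} {b} {c} r a≢c b≢c = trans (sgn-swap (b ∷ r) a≢c)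
  (sgn-∷-flip a (c ∷ b ∷ r) (b ∷ c ∷ r) (⊕-swap (c <ᶠ a) (b <ᶠ a) (below a r)) (sgn-swap r b≢c))

-- Rule (iii) is a product of two transpositions.
sgn-swp : {a b c : Fin n} (r : Vec (Fin n) k) (i : Fin k) → a ≢ b → Vec.Unique (c ∷ r) →
          sgn (swp i (a ∷ b ∷ c ∷ r)) ≡ sgn (a ∷ b ∷ c ∷ r)
sgn-swp {a = a} {b} {c} r i a≢b u =
  trans (sgn-swap t a≢b)
    (sgn-∷-flip a (b ∷ t) (b ∷ c ∷ r) (cong ((b <ᶠ a) ⊕_) (below-exchange a c r i))
      (trans (sym (ℙ.⁻¹-involutive (sgn (b ∷ t))))
        (cong _⁻¹ (sgn-∷-flip b t (c ∷ r) (below-exchange b c r i) (sgn-exchange r i u)))))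
  where t = lookup r i ∷ (r [ i ]≔ c)

-- Lifting tuples to even permutations

¬¬-Π-Fin : ∀ n {P : Fin n → Set} → (∀ i → ¬ ¬ P i) → ¬ ¬ (∀ i → P i)
¬¬-Π-Fin zero    _   ¬ps = ¬ps λ ()
¬¬-Π-Fin (suc n) ¬¬p ¬ps = ¬¬p zero λ p₀ → ¬¬-Π-Fin n (¬¬p ∘ suc) λ ps → ¬ps λ { zero → p₀ ; (suc i) → ps i }

-- There are finitely many vectors, so all instances of excluded middle may be assumed together when
-- the goal is `⊥`. This replaces deciding reachability.
¬¬-dec-Vec : ∀ {n} k (P : Vec (Fin n) k → Set) → ¬ ¬ (∀ v → Dec (P v))
¬¬-dec-Vec zero    P ¬dec = ¬¬-excluded-middle λ d → ¬dec λ { [] → d }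
¬¬-dec-Vec (suc k) P ¬dec =
  ¬¬-Π-Fin _ (λ x → ¬¬-dec-Vec k (P ∘ (x ∷_))) λ d → ¬dec λ { (x ∷ v) → d x v }

module Network (m : ℕ) where

  open Star {Fin (3 + m)} Fin._≟_

  String : Set
  String = Vec (Fin (3 + m)) (3 + m)

  Tuple : Set
  Tuple = Vec (Fin (3 + m)) (1 + m)

  symbols : List (Fin (3 + m))
  symbols = allFin (3 + m)

  symbols! : Unique symbols
  symbols! = Unique.allFin⁺ (3 + m)

  length-symbols : length symbols ≡ 3 + m
  length-symbols = length-tabulate {n = 3 + m} id

  unique⇒ok : {t : Tuple} → Vec.Unique t → Ok symbols t
  unique⇒ok ut = VecAll.universal ∈-allFin _ , ut

  drop₂ : String → Tuple
  drop₂ (_ ∷ _ ∷ t) = t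

  Even : String → Set
  Even p = Vec.Unique p × sgn p ≡ 0ℙ

  vert⇒even : ∀ {p} → IsEvenPermutation p → Even p
  vert⇒even {p} (perm , even) =
    subst Vec.Unique (Vec.tabulate∘lookup p) (VecUnique.tabulate⁺ (perm _ _)) , even⇒sgn p even

  even⇒vert : ∀ {p} → Even p → IsEvenPermutation p
  even⇒vert {p} (up , e) = VecUnique.lookup-injective up , sgn⇒even p e

  -- Otherwise `y` and the entries of `p` would be `4 + m` distinct symbols.
  occurs : ∀ {p : String} → Vec.Unique p → ∀ y → ∃ λ i → y ≡ lookup p i
  occurs {p} up y with y ∈? map (lookup p) symbols
    where open import Data.List.Membership.DecPropositional Fin._≟_ using (_∈?_)
  ... | yes y∈ = let i , _ , eq = ∈-map⁻ (lookup p) y∈ in i , eq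
  ... | no  y∉ = contradiction
    (unique⊆⇒length≤ {ys = symbols}
      (All.tabulate (λ z∈ y≡z → y∉ (subst (_∈ _) (sym y≡z) z∈)) ∷ Unique.map⁺ (VecUnique.lookup-injective up _ _) symbols!)
      (λ _ → ∈-allFin _))
    (<⇒≱ (s≤s (≤-reflexive (sym (length-map (lookup p) symbols)))))

  drop₂-injective : ∀ {p q} → Even p → Even q → drop₂ p ≡ drop₂ q → p ≡ q
  drop₂-injective {a ∷ b ∷ t} {a′ ∷ b′ ∷ .t} (up@((a≢b ∷ _) ∷ _) , ep) (((a′≢b′ ∷ a′∉t) ∷ (b′∉t ∷ _)) , eq) refl
    with occurs up a′ | occurs up b′
  ... | zero , refl | zero , refl         = contradiction refl a′≢b′
  ... | zero , refl | suc zero , refl     = refl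
  ... | suc zero , refl | suc zero , refl = contradiction refl a′≢b′
  ... | suc zero , refl | zero , refl     = contradiction
    (trans (sym (trans (sgn-swap t a≢b) (cong _⁻¹ ep))) eq) λ ()
  ... | suc (suc i) , a′≡ | _             = contradiction a′≡ (VecAll.lookup⁺ a′∉t i)
  ... | _ | suc (suc i) , b′≡             = contradiction b′≡ (VecAll.lookup⁺ b′∉t i)

  abstract
    missing : (t : Tuple) → ∃₂ λ a b → a ≢ b × (∀ i → a ≢ lookup t i) × (∀ i → b ≢ lookup t i)
    missing t =
      let a , _ , a∉ = ∃∉ ts symbols! (≤-trans (n≤1+n _) bound)
          b , _ , b∉ = ∃∉ (a ∷ ts) symbols! bound
      in a , b , (λ a≡b → b∉ (here (sym a≡b))) ,
         (λ i a≡ → a∉ (subst (_∈ ts) (sym a≡) (∈-map⁺ (lookup t) (∈-allFin i)))) ,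
         (λ i b≡ → b∉ (there (subst (_∈ ts) (sym b≡) (∈-map⁺ (lookup t) (∈-allFin i)))))
      where
      ts : List (Fin (3 + m))
      ts = map (lookup t) (allFin (1 + m))
      bound : 2 + length ts ≤ length symbols
      bound = ≤-reflexive (trans (cong (2 +_) (trans (length-map (lookup t) (allFin (1 + m))) (length-tabulate {n = 1 + m} id)))
                                 (sym length-symbols))

  -- Two missing symbols are put in front in the order that gives sign zero. The string is built for
  -- every tuple, which makes `lift` a total section of `drop₂`; evenness is claimed for injective
  -- tuples.
  even-lift : (t : Tuple) → ∃ λ p → drop₂ p ≡ t × (Vec.Unique t → Even p)
  even-lift t with missing t
  ... | a , b , a≢b , a∉ , b∉ with sgn (a ∷ b ∷ t) in e
  ...   | 0ℙ = a ∷ b ∷ t , refl , λ ut → ((a≢b ∷ VecAll.lookup⁻ a∉) ∷ VecAll.lookup⁻ b∉ ∷ ut) , e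
  ...   | 1ℙ = b ∷ a ∷ t , refl , λ ut → (((a≢b ∘ sym) ∷ VecAll.lookup⁻ b∉) ∷ VecAll.lookup⁻ a∉ ∷ ut) ,
                                         trans (sgn-swap t a≢b) (cong _⁻¹ e)

  lift : Tuple → String
  lift t = proj₁ (even-lift t)

  drop₂-lift : ∀ t → drop₂ (lift t) ≡ t
  drop₂-lift t = proj₁ (proj₂ (even-lift t))

  lift-even : ∀ {t} → Vec.Unique t → Even (lift t)
  lift-even {t} = proj₂ (proj₂ (even-lift t))

  lift-injective : ∀ {t u} → lift t ≡ lift u → t ≡ u
  lift-injective {t} {u} eq = trans (sym (drop₂-lift t)) (trans (cong drop₂ eq) (drop₂-lift u))

  drop₂-unique : ∀ {p} → Even p → Vec.Unique (drop₂ p)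
  drop₂-unique {_ ∷ _ ∷ _} ((_ ∷ _ ∷ ut) , _) = ut

  lift-drop₂ : ∀ {p} → Even p → lift (drop₂ p) ≡ p
  lift-drop₂ {p} ep = drop₂-injective (lift-even (drop₂-unique ep)) ep (drop₂-lift (drop₂ p))

  ≔-rename : ∀ {k} {c} {r : Vec (Fin (3 + m)) k} i → Vec.Unique r → r [ i ]≔ c ≡ Vec.map (rename (lookup r i) c) r
  ≔-rename {c = c} {z ∷ r} zero (z≢r ∷ _) = cong₂ _∷_ (sym (rename-≡ z)) (sym (map-rename-≢ z≢r))
  ≔-rename {r = z ∷ r} (suc i) (z≢r ∷ ur) = cong₂ _∷_ (sym (rename-≢ (VecAll.lookup⁺ z≢r i))) (≔-rename i ur)

  drop₂-swp : ∀ {a b c} {r : Vec (Fin (3 + m)) m} i → Vec.Unique r →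
              drop₂ (swp i (a ∷ b ∷ c ∷ r)) ≡ nb (lookup r i) (c ∷ r)
  drop₂-swp i ur = cong (_ ∷_) (≔-rename i ur)

  adj-sym : ∀ {p q} → ANAdj m p q → ANAdj m q p
  adj-sym {_ ∷ _ ∷ _ ∷ _} (inj₁ refl)        = inj₂ (inj₁ refl)
  adj-sym {_ ∷ _ ∷ _ ∷ _} (inj₂ (inj₁ refl)) = inj₁ refl
  adj-sym {a ∷ b ∷ c ∷ r} (inj₂ (inj₂ (i , refl))) = inj₂ (inj₂ (i , sym (cong (λ t → a ∷ b ∷ t)
    (cong₂ _∷_ (Vec.lookup∘update i r c) (trans (Vec.[]≔-idempotent r i) (Vec.[]≔-lookup r i))))))

  -- A rotation brings one of the two dropped symbols to the head of the tuple, while `swp i`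
  -- exchanges the head with entry `i`. All these moves preserve the sign.
  adj⇒nb : ∀ {p q} → Even p → ANAdj m p q → Even q × ∃ λ y → y ≢ Vec.head (drop₂ p) × drop₂ q ≡ nb y (drop₂ p)
  adj⇒nb {a ∷ b ∷ c ∷ r} (((a≢b ∷ a≢c ∷ a∉r) ∷ (b≢c ∷ b∉r) ∷ c∉r ∷ ur) , e) (inj₁ refl) =
    (((a≢c ∘ sym) ∷ (b≢c ∘ sym) ∷ c∉r) ∷ (a≢b ∷ a∉r) ∷ b∉r ∷ ur ,
     trans (sgn-rot r a≢c b≢c) e) ,
    b , b≢c , cong (b ∷_) (sym (map-rename-≢ b∉r))
  adj⇒nb {a ∷ b ∷ c ∷ r} (((a≢b ∷ a≢c ∷ a∉r) ∷ (b≢c ∷ b∉r) ∷ c∉r ∷ ur) , e) (inj₂ (inj₁ refl)) =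
    ((b≢c ∷ (a≢b ∘ sym) ∷ b∉r) ∷ ((a≢c ∘ sym) ∷ c∉r) ∷ a∉r ∷ ur ,
     trans (sym (sgn-rot r (a≢b ∘ sym) (a≢c ∘ sym))) e) ,
    a , a≢c , cong (a ∷_) (sym (map-rename-≢ a∉r))
  adj⇒nb {a ∷ b ∷ c ∷ r} (((a≢b ∷ a≢c ∷ a∉r) ∷ (b≢c ∷ b∉r) ∷ c∉r ∷ ur) , e) (inj₂ (inj₂ (i , refl))) =
    (((a≢b ∘ sym) ∷ b∉t) ∷ a∉t ∷ ut ,
     trans (sgn-swp r i a≢b (c∉r ∷ ur)) e) ,
    lookup r i , (λ eq → VecAll.lookup⁺ c∉r i (sym eq)) , drop₂-swp {a} {b} i ur
    where
    y = lookup r i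
    fresh : ∀ {x} → x ≢ c → VecAll.All (x ≢_) r → VecAll.All (x ≢_) (y ∷ (r [ i ]≔ c))
    fresh x≢c x∉r = VecAll.lookup⁺ x∉r i ∷ subst (VecAll.All _) (sym (≔-rename i ur)) (map-rename-all x≢c x∉r)
    a∉t = fresh a≢c a∉r
    b∉t = fresh b≢c b∉r
    ut : Vec.Unique (y ∷ (r [ i ]≔ c))
    ut = subst Vec.Unique (sym (drop₂-swp {a} {b} i ur))
           (proj₂ (nb-ok (unique⇒ok (c∉r ∷ ur)) (∈-allFin y) (λ eq → VecAll.lookup⁺ c∉r i (sym eq))))

  -- The position of `y` in `p` selects the rule.
  nb⇒adj : ∀ {p y} → Even p → y ≢ Vec.head (drop₂ p) → ∃ λ q → ANAdj m p q × drop₂ q ≡ nb y (drop₂ p)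
  nb⇒adj {p@(a ∷ b ∷ c ∷ r)} {y} (up@((_ ∷ a≢c ∷ a∉r) ∷ (_ ∷ b∉r) ∷ _ ∷ ur) , _) y≢c with occurs up y
  ... | zero , refl              = rot₂ p , inj₂ (inj₁ refl) , cong (y ∷_) (sym (map-rename-≢ a∉r))
  ... | suc zero , refl          = rot₁ p , inj₁ refl , cong (y ∷_) (sym (map-rename-≢ b∉r))
  ... | suc (suc zero) , y≡c     = contradiction y≡c y≢c
  ... | suc (suc (suc i)) , refl = swp i p , inj₂ (inj₂ (i , refl)) , drop₂-swp {a} {b} i ur

  adj-lift : ∀ {t y} → Vec.Unique t → y ≢ Vec.head t → ANAdj m (lift t) (lift (nb y t))
  adj-lift {t} {y} ut y≢ with nb⇒adj (lift-even ut) (subst (λ t → y ≢ Vec.head t) (sym (drop₂-lift t)) y≢)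
  ... | q , adj , eq = subst (ANAdj m (lift t)) (drop₂-injective eq-q (lift-even unb) (trans eq′ (sym (drop₂-lift _)))) adj
    where
    eq′ : drop₂ q ≡ nb y t
    eq′ = trans eq (cong (nb y) (drop₂-lift t))
    eq-q = proj₁ (adj⇒nb (lift-even ut) adj)
    unb : Vec.Unique (nb y t)
    unb = proj₂ (nb-ok (unique⇒ok ut) (∈-allFin y) y≢)

  -- From components to colourings

  module _ (S : List String) (vS : All IsEvenPermutation S) where

    private
      G = AN m
      F = map drop₂ S

    alive-lift : ∀ {t} → Live symbols F t → Alive G S (lift t)
    alive-lift {t} ((_ , ut) , t∉) =
      even⇒vert (lift-even ut) , λ lift∈ → t∉ (subst (_∈ F) (drop₂-lift t) (∈-map⁺ drop₂ lift∈))

    alive-drop₂ : ∀ {p} → Alive G S p → Live symbols F (drop₂ p)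
    alive-drop₂ {p} (vp , p∉) = unique⇒ok (drop₂-unique (vert⇒even {p} vp)) , λ d∈ →
      let s , s∈ , eq = ∈-map⁻ drop₂ d∈ in
      p∉ (subst (_∈ S) (sym (drop₂-injective (vert⇒even vp) (vert⇒even (All.lookup vS s∈)) eq)) s∈)

    snoc : ∀ {u v w} → Reach G S u v → ANAdj m v w → Alive G S w → Reach G S u w
    snoc here           adj a = step adj a here
    snoc (step e b r) adj a = step e b (snoc r adj a)

    -- Colour a string by the index of the first of `x₀`, `x₁`, `x₂` that reaches it, and by 3 if
    -- none does. Adjacent non-faulty strings get equal colours, yet the four given vertices get
    -- four different ones.
    no-four-components : 4 + length S ≤ 3 * (2 + m) → Bounds m → ¬ AtLeastComponents G 4 S
    no-four-components few bs (xs@(x₀ ∷ x₁ ∷ x₂ ∷ x₃ ∷ []) , alive , apart) =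
      ¬¬-dec-Vec _ (Reach G S x₀) λ d₀ → ¬¬-dec-Vec _ (Reach G S x₁) λ d₁ → ¬¬-dec-Vec _ (Reach G S x₂) λ d₂ →
      contradict d₀ d₁ d₂
      where
      module _ (d₀ : ∀ v → Dec (Reach G S x₀ v)) (d₁ : ∀ v → Dec (Reach G S x₁ v)) (d₂ : ∀ v → Dec (Reach G S x₂ v)) where
        classify : ∀ {A B C : Set} → Dec A → Dec B → Dec C → ℕ
        classify (yes _) _ _ = 0
        classify (no _) (yes _) _ = 1
        classify (no _) (no _) (yes _) = 2
        classify (no _) (no _) (no _) = 3
        component : String → ℕ
        component v = classify (d₀ v) (d₁ v) (d₂ v)
        same : ∀ {A B C A′ B′ C′ : Set} (a : Dec A) (b : Dec B) (c : Dec C) (a′ : Dec A′) (b′ : Dec B′) (c′ : Dec C′) →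
               (A → A′) → (A′ → A) → (B → B′) → (B′ → B) → (C → C′) → (C′ → C) → classify a b c ≡ classify a′ b′ c′
        same (yes a) _ _ (no ¬a) _ _ f _ _ _ _ _ = contradiction (f a) ¬a
        same (no ¬a) _ _ (yes a) _ _ _ f _ _ _ _ = contradiction (f a) ¬a
        same (yes _) _ _ (yes _) _ _ _ _ _ _ _ _ = refl
        same (no _) (yes b) _ (no _) (no ¬b) _ _ _ f _ _ _ = contradiction (f b) ¬b
        same (no _) (no ¬b) _ (no _) (yes b) _ _ _ _ f _ _ = contradiction (f b) ¬b
        same (no _) (yes _) _ (no _) (yes _) _ _ _ _ _ _ _ = refl
        same (no _) (no _) (yes c) (no _) (no _) (no ¬c) _ _ _ _ f _ = contradiction (f c) ¬c
        same (no _) (no _) (no ¬c) (no _) (no _) (yes c) _ _ _ _ _ f = contradiction (f c) ¬c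
        same (no _) (no _) (yes _) (no _) (no _) (yes _) _ _ _ _ _ _ = refl
        same (no _) (no _) (no _) (no _) (no _) (no _) _ _ _ _ _ _ = refl
        invariant : ∀ {v w} → Alive G S v → Alive G S w → ANAdj m v w → component v ≡ component w
        invariant {v} {w} av aw adj = same (d₀ v) (d₁ v) (d₂ v) (d₀ w) (d₁ w) (d₂ w) to from to from to from
          where
          to : ∀ {u} → Reach G S u v → Reach G S u w
          to r = snoc r adj aw
          from : ∀ {u} → Reach G S u w → Reach G S u v
          from r = snoc r (adj-sym adj) av
        colouring : Colouring symbols F (component ∘ lift)
        colouring t a@(ok , _) y∈ y≢ nb∉ =
          invariant (alive-lift a) (alive-lift (nb-ok ok y∈ y≢ , nb∉)) (adj-lift (proj₂ ok) y≢)
        c₀ : component x₀ ≡ 0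
        c₀ with d₀ x₀
        ... | yes _ = refl
        ... | no ¬r = contradiction here ¬r
        c₁ : component x₁ ≡ 1
        c₁ with d₀ x₁ | d₁ x₁
        ... | yes r | _ = contradiction r (apart zero (suc zero) λ ())
        ... | no _ | yes _ = refl
        ... | no _ | no ¬r = contradiction here ¬r
        c₂ : component x₂ ≡ 2
        c₂ with d₀ x₂ | d₁ x₂ | d₂ x₂
        ... | yes r | _ | _ = contradiction r (apart zero (suc (suc zero)) λ ())
        ... | no _ | yes r | _ = contradiction r (apart (suc zero) (suc (suc zero)) λ ())
        ... | no _ | no _ | yes _ = refl
        ... | no _ | no _ | no ¬r = contradiction here ¬r
        c₃ : component x₃ ≡ 3
        c₃ with d₀ x₃ | d₁ x₃ | d₂ x₃
        ... | yes r | _ | _ = contradiction r (apart zero (suc (suc (suc zero))) λ ())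
        ... | no _ | yes r | _ = contradiction r (apart (suc zero) (suc (suc (suc zero))) λ ())
        ... | no _ | no _ | yes r = contradiction r (apart (suc (suc zero)) (suc (suc (suc zero))) λ ())
        ... | no _ | no _ | no _ = refl
        colour : ∀ {x n} → Alive G S x → component x ≡ n → component (lift (drop₂ x)) ≡ n
        colour (vx , _) eq = trans (cong component (lift-drop₂ (vert⇒even vx))) eq
        a₀ = alive zero
        a₁ = alive (suc zero)
        a₂ = alive (suc (suc zero))
        a₃ = alive (suc (suc (suc zero)))
        colours : map (component ∘ lift) (drop₂ x₀ ∷ drop₂ x₁ ∷ drop₂ x₂ ∷ drop₂ x₃ ∷ []) ≡ 0 ∷ 1 ∷ 2 ∷ 3 ∷ []
        colours = cong₂ _∷_ (colour a₀ c₀) (cong₂ _∷_ (colour a₁ c₁) (cong₂ _∷_ (colour a₂ c₂) (cong₂ _∷_ (colour a₃ c₃) refl)))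
        contradict : ⊥
        contradict = 1+n≰n (Bounds.three bs symbols! (≤-reflexive (sym length-symbols)) colouring
          (subst (λ l → 4 + l ≤ 3 * (2 + m)) (sym (length-map drop₂ S)) few)
          (alive-drop₂ a₀ ∷ alive-drop₂ a₁ ∷ alive-drop₂ a₂ ∷ alive-drop₂ a₃ ∷ [])
          (subst Unique (sym colours) (Unique.upTo⁺ 4)))

-- Lower bound 3n - 6 for n = 4 + k

module Connectivity (k : ℕ) where

  private m = suc k
  open Network m
  open Star {Fin (3 + m)} Fin._≟_

  private G = AN m

  private
    corners : List (Fin (3 + m))
    corners = zero ∷ suc zero ∷ suc (suc zero) ∷ suc (suc (suc zero)) ∷ []

    corners! : Unique corners
    corners! = ((λ ()) ∷ (λ ()) ∷ (λ ()) ∷ []) ∷ ((λ ()) ∷ (λ ()) ∷ []) ∷ ((λ ()) ∷ []) ∷ [] ∷ []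

  abstract
    -- One of four copies has fewer than `2 + m` faults, while `2 + m` heads are available in it. A
    -- head used by none of these faults extends to a non-faulty tuple.
    another : (F : List Tuple) → length F < 4 * (2 + m) → ∃ λ t → Live symbols F t
    another F few with All.all? (λ x → 2 + m ≤? count (second? x) F) corners
    ... | yes all = contradiction (packing second F corners! all) (<⇒≱ few)
    ... | no ¬all with Any.satisfied (¬All⇒Any¬ (λ x → 2 + m ≤? count (second? x) F) _ ¬all)
    ...   | x , ≱ =
      let c , c∈ , c∉ = ∃∉ {symbols - x} (map Vec.head (filter (second? x) F)) (unique-- {symbols} {x} symbols!)
                           (≤-trans (s≤s (≤-reflexive (length-map Vec.head (filter (second? x) F)))) (≤-trans (≰⇒> ≱) L≥))
          r , okr = ∃-ok₂ k {symbols} symbols! (≤-trans (m≤n+m (2 + k) 2) (≤-reflexive (sym length-symbols))) (∈-allFin x) c∈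
      in c ∷ x ∷ r , ok-swap {L = symbols} okr , λ t∈ → c∉ (∈-map⁺ Vec.head (∈-filter⁺ (second? x) t∈ refl))
      where
      L≥ : 2 + m ≤ length (symbols - x)
      L≥ = s≤s⁻¹ (≤-trans (≤-reflexive (sym length-symbols)) (length≤1+length-- {symbols} x symbols!))

  -- `another` is applied four times, each tuple found being added to the faults.
  enough-vertices : ∀ {S} → All IsEvenPermutation S → length S < 3 * (1 + m) → ¬ FewerVertices G 4 S
  enough-vertices {S} vS few none =
    let t₀ , a₀          = another F (bound 0 z≤n)
        t₁ , ok₁ , t₁∉   = another (t₀ ∷ F) (bound 1 (s≤s z≤n))
        t₂ , ok₂ , t₂∉   = another (t₁ ∷ t₀ ∷ F) (bound 2 (s≤s (s≤s z≤n)))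
        t₃ , ok₃ , t₃∉   = another (t₂ ∷ t₁ ∷ t₀ ∷ F) (bound 3 ≤-refl)
        distinct : Vec.Unique (t₃ ∷ t₂ ∷ t₁ ∷ t₀ ∷ [])
        distinct = ((t₃∉ ∘ here) ∷ (t₃∉ ∘ there ∘ here) ∷ (t₃∉ ∘ there ∘ there ∘ here) ∷ []) ∷
                   ((t₂∉ ∘ here) ∷ (t₂∉ ∘ there ∘ here) ∷ []) ∷ ((t₁∉ ∘ here) ∷ []) ∷ [] ∷ []
        alive : VecAll.All (Alive G S) (Vec.map lift (t₃ ∷ t₂ ∷ t₁ ∷ t₀ ∷ []))
        alive = alive-lift S vS (ok₃ , t₃∉ ∘ there ∘ there ∘ there) ∷ alive-lift S vS (ok₂ , t₂∉ ∘ there ∘ there) ∷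
                alive-lift S vS (ok₁ , t₁∉ ∘ there) ∷ alive-lift S vS a₀ ∷ []
    in none (Vec.map lift (t₃ ∷ t₂ ∷ t₁ ∷ t₀ ∷ []) , VecAll.lookup⁺ alive ,
             λ i j i≢j eq → i≢j (VecUnique.lookup-injective (VecUnique.map⁺ lift-injective distinct) i j eq))
    where
    F = map drop₂ S
    bound : ∀ i → i ≤ 3 → i + length F < 4 * (2 + m)
    bound i i≤3 = ≤-<-trans (+-mono-≤ i≤3 (≤-reflexive (length-map drop₂ S)))
      (≤-trans (+-monoʳ-< 3 few) (≤-trans (≤-reflexive (sym (*-suc 3 (1 + m)))) (*-monoˡ-≤ (2 + m) (n≤1+n 3))))

  lower-bound : ∀ S → VertexSet G S → ComponentCut G 4 S → 3 * (1 + m) ≤ length S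
  lower-bound S (vS , _) cut = ≮⇒≥ λ few → Sum.[
    no-four-components S vS (≤-trans (+-monoʳ-< 3 few) (≤-reflexive (sym (*-suc 3 (1 + m))))) (bounds k) ,
    enough-vertices vS few ] cut

  -- A cut of size 3n - 6 that leaves four components

  private
    others : List (Fin (3 + m))
    others = map (λ i → suc (suc (suc i))) (allFin m)

    others! : Unique others
    others! = Unique.map⁺ (λ { refl → refl }) (Unique.allFin⁺ m)

    length-others : length others ≡ m
    length-others = trans (length-map _ (allFin m)) (length-tabulate {n = m} id)

    abstract
      tail : ∃ λ (r : Vec (Fin (3 + m)) k) → Ok others r
      tail = ∃-ok k others! (≤-trans (n≤1+n k) (≤-reflexive (sym length-others)))

      -- Its second symbol keeps it out of the three copies that contain the cut.
      fourth : ∃ λ (t : Tuple) → Ok symbols t × second t ≡ suc (suc (suc zero))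
      fourth =
        let r , okr = ∃-ok₂ k {symbols} symbols! (≤-trans (m≤n+m (2 + k) 2) (≤-reflexive (sym length-symbols)))
                        (∈-allFin zero) (∈-- {symbols} {zero} (∈-allFin (suc (suc (suc zero)))) λ ())
        in zero ∷ suc (suc (suc zero)) ∷ r , okr , refl

    r : Vec (Fin (3 + m)) k
    r = proj₁ tail

    -- The symbols 0, 1, 2 in cyclic arrangement. The vertex `x ∷ z ∷ r` is the centre to be
    -- isolated, and the next corner is `w`, `x`, `z`.
    record Corner (x z w : Fin (3 + m)) : Set where
      constructor corner
      field
        x≢z : x ≢ z
        x≢w : x ≢ w
        z≢w : z ≢ w
        x∉  : x ∉ others
        z∉  : z ∉ others
        w∉  : w ∉ others
        cover : ∀ y → y ≡ x ⊎ y ≡ z ⊎ y ∈ w ∷ others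

    fresh : ∀ {x} → x ∉ others → VecAll.All (x ≢_) r
    fresh x∉ = VecAll.map (λ y∈ x≡y → x∉ (subst (_∈ others) (sym x≡y) y∈)) (proj₁ (proj₂ tail))

    -- The neighbours of the centre within its own copy; `y ≡ z` would give the external one.
    group : (x z w : Fin (3 + m)) → List Tuple
    group x z w = map (λ y → nb y (x ∷ z ∷ r)) (w ∷ others)

    module _ {x z w} (co : Corner x z w) where
      open Corner co

      center! : Vec.Unique (x ∷ z ∷ r)
      center! = (x≢z ∷ fresh x∉) ∷ fresh z∉ ∷ proj₂ (proj₂ tail)

      toward≢ : ∀ {y} → y ∈ w ∷ others → y ≢ x × y ≢ z
      toward≢ (here refl) = (λ eq → x≢w (sym eq)) , (λ eq → z≢w (sym eq))
      toward≢ (there y∈)  = (λ { refl → x∉ y∈ }) , (λ { refl → z∉ y∈ })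

      group-ends : ∀ {t} → t ∈ group x z w → second t ≡ z × Vec.head t ∈ w ∷ others
      group-ends t∈ with ∈-map⁻ (λ y → nb y (x ∷ z ∷ r)) t∈
      ... | y , y∈ , refl = rename-≢ (λ z≡y → proj₂ (toward≢ y∈) (sym z≡y)) , y∈

      group! : Unique (group x z w)
      group! = Unique.map⁺ (cong Vec.head) (All.tabulate (λ { y∈ refl → w∉ y∈ }) ∷ others!)

      group-unique : ∀ {t} → t ∈ group x z w → Vec.Unique t
      group-unique t∈ with ∈-map⁻ (λ y → nb y (x ∷ z ∷ r)) t∈
      ... | y , y∈ , refl = proj₂ (nb-ok (unique⇒ok center!) (∈-allFin y) (proj₁ (toward≢ y∈)))

      length-group : length (group x z w) ≡ 1 + m
      length-group = cong suc (trans (length-map _ others) length-others)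

      -- The external neighbour z x r of the centre x z r is the first
      -- member of the next group.
      neighbour : ∀ {y} → y ≢ x → nb y (x ∷ z ∷ r) ∈ group x z w ⊎ nb y (x ∷ z ∷ r) ∈ group w x z
      neighbour {y} y≢x with cover y
      ... | inj₁ y≡x         = contradiction y≡x y≢x
      ... | inj₂ (inj₂ y∈)   = inj₁ (∈-map⁺ _ y∈)
      ... | inj₂ (inj₁ refl) = inj₂ (here (trans (nb-second (unique⇒ok center!))
        (sym (cong₂ (λ p q → z ∷ p ∷ q) (rename-≢ x≢z) (map-rename-≢ (fresh z∉))))))

    pattern 0F = zero
    pattern 1F = suc zero
    pattern 2F = suc (suc zero)

    small∉ : ∀ {x : Fin (3 + m)} → toℕ x < 3 → x ∉ others
    small∉ x<3 x∈ with ∈-map⁻ (λ i → suc (suc (suc i))) x∈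
    small∉ (s≤s (s≤s (s≤s ()))) x∈ | _ , _ , refl

    1<3 : 1 < 3
    1<3 = s≤s (s≤s z≤n)

    cornerᵃ : Corner 1F 0F 2F
    cornerᵃ = corner (λ ()) (λ ()) (λ ()) (small∉ 1<3) (small∉ (s≤s z≤n)) (small∉ ≤-refl) λ where
      0F                  → inj₂ (inj₁ refl)
      1F                  → inj₁ refl
      2F                  → inj₂ (inj₂ (here refl))
      (suc (suc (suc i))) → inj₂ (inj₂ (there (∈-map⁺ _ (∈-allFin i))))

    cornerᵇ : Corner 2F 1F 0F
    cornerᵇ = corner (λ ()) (λ ()) (λ ()) (small∉ ≤-refl) (small∉ 1<3) (small∉ (s≤s z≤n)) λ where
      0F                  → inj₂ (inj₂ (here refl))
      1F                  → inj₂ (inj₁ refl)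
      2F                  → inj₁ refl
      (suc (suc (suc i))) → inj₂ (inj₂ (there (∈-map⁺ _ (∈-allFin i))))

    cornerᶜ : Corner 0F 2F 1F
    cornerᶜ = corner (λ ()) (λ ()) (λ ()) (small∉ (s≤s z≤n)) (small∉ ≤-refl) (small∉ 1<3) λ where
      0F                  → inj₁ refl
      1F                  → inj₂ (inj₂ (here refl))
      2F                  → inj₂ (inj₁ refl)
      (suc (suc (suc i))) → inj₂ (inj₂ (there (∈-map⁺ _ (∈-allFin i))))

    A = group 1F 0F 2F
    B = group 2F 1F 0F
    C = group 0F 2F 1F

    cut : List Tuple
    cut = A ++ B ++ C

    cut⁻ : ∀ {t} → t ∈ cut → t ∈ A ⊎ t ∈ B ⊎ t ∈ C
    cut⁻ t∈ = Sum.map₂ (∈-++⁻ B) (∈-++⁻ A t∈)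

    A⊆ : ∀ {t} → t ∈ A → t ∈ cut
    A⊆ = ∈-++⁺ˡ
    B⊆ : ∀ {t} → t ∈ B → t ∈ cut
    B⊆ = ∈-++⁺ʳ A ∘ ∈-++⁺ˡ
    C⊆ : ∀ {t} → t ∈ C → t ∈ cut
    C⊆ = ∈-++⁺ʳ A ∘ ∈-++⁺ʳ B

    disjoint : ∀ {x z w x′ z′ w′} → Corner x z w → Corner x′ z′ w′ → z ≢ z′ → ∀ {t} →
               t ∈ group x z w → t ∈ group x′ z′ w′ → ⊥
    disjoint co co′ z≢z′ t∈ t∈′ = z≢z′ (trans (sym (proj₁ (group-ends co t∈))) (proj₁ (group-ends co′ t∈′)))

    cut! : Unique cut
    cut! = Unique.++⁺ (group! cornerᵃ)
      (Unique.++⁺ (group! cornerᵇ) (group! cornerᶜ) λ (b , c) → disjoint cornerᵇ cornerᶜ (λ ()) b c)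
      λ (a , bc) → Sum.[ disjoint cornerᵃ cornerᵇ (λ ()) a , disjoint cornerᵃ cornerᶜ (λ ()) a ] (∈-++⁻ B bc)

    cut-unique : ∀ {t} → t ∈ cut → Vec.Unique t
    cut-unique t∈ = Sum.[ group-unique cornerᵃ , Sum.[ group-unique cornerᵇ , group-unique cornerᶜ ] ] (cut⁻ t∈)

    cut-ends : ∀ {t} → t ∈ cut → (second t ≡ 0F × Vec.head t ∈ 2F ∷ others) ⊎
                                 (second t ≡ 1F × Vec.head t ∈ 0F ∷ others) ⊎
                                 (second t ≡ 2F × Vec.head t ∈ 1F ∷ others)
    cut-ends t∈ = Sum.map (group-ends cornerᵃ) (Sum.map (group-ends cornerᵇ) (group-ends cornerᶜ)) (cut⁻ t∈)

    length-cut : length cut ≡ 3 * (3 + m) ∸ 6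
    length-cut = trans (length-++ A) (trans (cong₂ _+_ (length-group cornerᵃ) (trans (length-++ B)
      (cong₂ _+_ (length-group cornerᵇ) (trans (length-group cornerᶜ) (sym (+-identityʳ _))))))
      (sym (trans (cong (_∸ 6) (*-distribˡ-+ 3 2 (1 + m))) (m+n∸m≡n 6 (3 * (1 + m))))))

    S : List String
    S = map lift cut

    ∉S : ∀ {t} → t ∉ cut → lift t ∉ S
    ∉S t∉ lt∈ with ∈-map⁻ lift lt∈
    ... | u , u∈ , eq = t∉ (subst (_∈ cut) (sym (lift-injective eq)) u∈)

    Isolated : String → Set
    Isolated p = ∀ {q} → Alive G S q → ¬ ANAdj m p q

    isolated : ∀ {v} → Vec.Unique v → (∀ {y} → y ≢ Vec.head v → nb y v ∈ cut) → Isolated (lift v)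
    isolated {v} uv near {q} (_ , q∉S) adj with adj⇒nb (lift-even uv) adj
    ... | eq , y , y≢ , q≡ = q∉S (subst (_∈ S) (lift-drop₂ eq) (∈-map⁺ lift
      (subst (_∈ cut) (sym q≡) (subst (λ t → nb y t ∈ cut) (sym (drop₂-lift v))
        (near (subst (λ t → y ≢ Vec.head t) (drop₂-lift v) y≢))))))

    reach-from : ∀ {p q} → Isolated p → Reach G S p q → p ≡ q
    reach-from iso here           = refl
    reach-from iso (step adj a _) = contradiction adj (iso a)

    -- By symmetry of adjacency, the last step into `q` would give `q` a non-faulty neighbour.
    reach-to : ∀ {p q} → Alive G S p → Isolated q → Reach G S p q → p ≡ q
    reach-to ap iso here = refl
    reach-to ap iso (step adj a r) with reach-to a iso r
    ... | refl = contradiction (adj-sym adj) (iso ap)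

    -- Ordered so that entry `i` has second symbol `i`, which makes the entries distinct.
    tuples : Vec Tuple 4
    tuples = (1F ∷ 0F ∷ r) ∷ (2F ∷ 1F ∷ r) ∷ (0F ∷ 2F ∷ r) ∷ proj₁ fourth ∷ []

    tuple-ok : ∀ i → Ok symbols (lookup tuples i)
    tuple-ok 0F = unique⇒ok (center! cornerᵃ)
    tuple-ok 1F = unique⇒ok (center! cornerᵇ)
    tuple-ok 2F = unique⇒ok (center! cornerᶜ)
    tuple-ok (suc (suc (suc zero))) = proj₁ (proj₂ fourth)

    seconds : ∀ i → toℕ (second (lookup tuples i)) ≡ toℕ i
    seconds 0F = refl
    seconds 1F = refl
    seconds 2F = refl
    seconds (suc (suc (suc zero))) = cong toℕ (proj₂ (proj₂ fourth))

    -- The second symbol of a centre admits only its own group, in which every head differs from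
    -- that of the centre.
    tuple∉ : ∀ i → lookup tuples i ∉ cut
    tuple∉ 0F t∈ with cut-ends t∈
    ... | inj₁ (_ , there 1∈)    = small∉ 1<3 1∈
    ... | inj₂ (inj₁ (() , _))
    ... | inj₂ (inj₂ (() , _))
    tuple∉ 1F t∈ with cut-ends t∈
    ... | inj₂ (inj₁ (_ , there 2∈)) = small∉ ≤-refl 2∈
    ... | inj₂ (inj₂ (() , _))
    tuple∉ 2F t∈ with cut-ends t∈
    ... | inj₂ (inj₁ (() , _))
    ... | inj₂ (inj₂ (_ , there 0∈)) = small∉ (s≤s z≤n) 0∈
    tuple∉ (suc (suc (suc zero))) t∈ with cut-ends t∈
    ... | inj₁ (eq , _)        = contradiction (trans (sym (proj₂ (proj₂ fourth))) eq) λ ()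
    ... | inj₂ (inj₁ (eq , _)) = contradiction (trans (sym (proj₂ (proj₂ fourth))) eq) λ ()
    ... | inj₂ (inj₂ (eq , _)) = contradiction (trans (sym (proj₂ (proj₂ fourth))) eq) λ ()

    vertices : Vec String 4
    vertices = Vec.map lift tuples

    lookup-vertices : ∀ i → lookup vertices i ≡ lift (lookup tuples i)
    lookup-vertices i = Vec.lookup-map i lift tuples

    vertex-alive : ∀ i → Alive G S (lookup vertices i)
    vertex-alive i rewrite lookup-vertices i = even⇒vert (lift-even (proj₂ (tuple-ok i))) , ∉S (tuple∉ i)

    vertices-injective : ∀ i j → lookup vertices i ≡ lookup vertices j → i ≡ j
    vertices-injective i j eq = Fin.toℕ-injective (trans (sym (seconds i)) (trans (cong (toℕ ∘ second) tuples≡) (seconds j)))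
      where
      tuples≡ : lookup tuples i ≡ lookup tuples j
      tuples≡ = lift-injective (trans (sym (lookup-vertices i)) (trans eq (lookup-vertices j)))

    only-last : ∀ i → Isolated (lookup vertices i) ⊎ i ≡ suc (suc (suc zero))
    only-last 0F = inj₁ (isolated (center! cornerᵃ) (Sum.[ A⊆ , B⊆ ] ∘ neighbour cornerᵃ))
    only-last 1F = inj₁ (isolated (center! cornerᵇ) (Sum.[ B⊆ , C⊆ ] ∘ neighbour cornerᵇ))
    only-last 2F = inj₁ (isolated (center! cornerᶜ) (Sum.[ C⊆ , A⊆ ] ∘ neighbour cornerᶜ))
    only-last (suc (suc (suc zero))) = inj₂ refl

    -- Only the last vertex may fail to be isolated, so one of two different vertices is isolated.
    separated : ∀ i j → i ≢ j → ¬ Reach G S (lookup vertices i) (lookup vertices j)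
    separated i j i≢j reach with only-last i | only-last j
    ... | inj₁ iso | _         = i≢j (vertices-injective i j (reach-from iso reach))
    ... | inj₂ _   | inj₁ iso  = i≢j (vertices-injective i j (reach-to (vertex-alive i) iso reach))
    ... | inj₂ i≡  | inj₂ j≡   = i≢j (trans i≡ (sym j≡))

  upper-bound : Σ (List String) λ S → VertexSet G S × length S ≡ 3 * (3 + m) ∸ 6 × ComponentCut G 4 S
  upper-bound = S ,
    (All.tabulate vert , Unique.map⁺ lift-injective cut!) ,
    trans (length-map lift cut) length-cut ,
    inj₁ (vertices , vertex-alive , separated)
    where
    vert : ∀ {p} → p ∈ S → IsEvenPermutation p
    vert p∈ with ∈-map⁻ lift p∈
    ... | t , t∈ , refl = even⇒vert (lift-even (cut-unique t∈))

theorem1 : (m : ℕ) → 1 ≤ m →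
    ComponentConnectivity (AN m) 4 (3 * (3 + m) ∸ 6)
theorem1 (suc k) _ = upper-bound , λ S vS cut → ≤-trans (≤-reflexive bound) (lower-bound S vS cut)
  where
  open Connectivity k
  bound : 3 * (4 + k) ∸ 6 ≡ 3 * (2 + k)
  bound = trans (cong (_∸ 6) (*-distribˡ-+ 3 2 (2 + k))) (m+n∸m≡n 6 (3 * (2 + k)))
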